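{- The category $\mathsf{LSPxJLat}$ of localized strong proximity $\vee$-semilattices and proximity relations is equivalent to the category of coalgebras of the double powerlocale comonad $\mathrm{P_U}\circ\mathrm{P_L}$ over $\mathsf{PxPos}$.
   Context: Work constructively; $\mathrm{Fin}(S)$ = finitely enumerable subsets, $\mathrm{Fin}^+(A)$ = inhabited finitely enumerable subsets of $A$. For $r\subseteq X\times Y$, $rx=\{y\mid x\,r\,y\}$, $r^-y=\{x\mid x\,r\,y\}$. Proximity poset: $(S,\le,\prec)$, $(S,\le)$ a poset, $\prec$ a relation with $\{b\mid b\prec a\}$ a rounded ideal (downward closed, inhabited, directed $I$ with $x\in I\iff\exists y\,(x\prec y\ \&\ y\in I)$) and $\{b\mid a\prec b\}$ a rounded upward closed set ($x\in U\iff\exists y\,(y\prec x\ \&\ y\in U)$) for every $a$. Approximable relation $(S,\prec)\to(S',\prec')$: $r\subseteq S\times S'$ with each $r^-b$ a rounded ideal and each $ra$ a rounded upward closed set. $\mathsf{PxPos}$: proximity posets and approximable relations, identity $\prec$, relational composition. A proximity $\vee$-semilattice is a proximity poset whose poset is a join-semilattice $(S,0,\vee)$; it is strong if $a\prec0\Rightarrow a=0$ and $a\prec b\vee c\Rightarrow\exists b',c'\,(a\le b'\vee c'\ \&\ b'\prec b\ \&\ c'\prec c)$; it is localized if $a\prec b\le c\vee d\Rightarrow\exists a_1\,\exists a_2\,(a_1\prec b\ \&\ a_1\prec c\ \&\ a_2\prec b\ \&\ a_2\prec d\ \&\ a\prec a_1\vee a_2)$. An approximable relation $r$ between proximity $\vee$-semilattices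 is join-approximable if $a\,r\,0'\Rightarrow a=0$ and $a\,r\,(b\vee'c)\Rightarrow\exists b',c'\,(a\le b'\vee c'\ \&\ b'\,r\,b\ \&\ c'\,r\,c)$; it is Lawson approximable if (i) $a\prec a'\Rightarrow\exists b\,(a\,r\,b)$ and (ii) $a\prec a'\ \&\ a'\,r\,b\ \&\ a'\,r\,c\Rightarrow\exists d\,(d\prec' b\ \&\ d\prec' c\ \&\ a\,r\,d)$. A proximity relation is a join-approximable Lawson approximable relation between localized strong proximity $\vee$-semilattices; $\mathsf{LSPxJLat}$ is the category of these (identities $\prec$, relational composition). For $r\subseteq S\times S'$: $A\,r_L\,B\iff\forall a\in A\,\exists b\in B\,(a\,r\,b)$; $A\,r_U\,B\iff\forall b\in B\,\exists a\in A\,(a\,r\,b)$. Comonad $\mathrm{P_L}$: $\mathrm{P_L}(S)=((\mathrm{Fin}(S),\le_L),\prec_L)$ (poset reflection), $\mathrm{P_L}(r)=r_L$, counit $A\,\varepsilon^L_S\,a\iff A\prec_L\{a\}$, comultiplication $A\,\nu^L_S\,\mathcal U\iff A\prec_L\bigcup\mathcal U$. Comonad $\mathrm{P_U}$: same with $U$ in place of $L$. For $\mathcal U\in\mathrm{Fin}(\mathrm{Fin}(S))$: $\emptyset^*=\{\emptyset\}$, $(\mathcal U\cup\{A\})^*=\{B\cup C\mid B\in\mathcal U^*,C\in\mathrm{Fin}^+(A)\}$; $\sigma_S:\mathrm{P_U}\mathrm{P_L}S\to\mathrm{P_L}\mathrm{P_U}S$, $\mathcal U\,\sigma_S\,\mathcal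 V\iff\mathcal U\,(\prec_L)_U\,\mathcal V^*$. The double powerlocale is the comonad $H=\mathrm{P_U}\circ\mathrm{P_L}$ with counit $\varepsilon^U_S\circ\mathrm{P_U}(\varepsilon^L_S)$ and comultiplication $\mathrm{P_U}(\sigma_{\mathrm{P_L}S})\circ\nu^U_{\mathrm{P_L}\mathrm{P_L}S}\circ\mathrm{P_U}(\nu^L_S)$; coalgebras and homomorphisms are the usual ones for a comonad. -}

module Defs where

open import Level using (Level; suc)
open import Data.List using (List; []; _∷_; _++_; [_]; concat)
open import Data.List.Membership.Propositional using (_∈_)
open import Data.List.Relation.Unary.All using (All)
open import Data.Product using (Σ; ∃; ∃-syntax; _×_; _,_)
open import Relation.Binary.PropositionalEquality using (_≡_)

private variable ℓ : Level

BRel : Set ℓ → Set ℓ → Set (suc ℓ)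
BRel {ℓ} X Y = X → Y → Set ℓ

Subset : Set ℓ → Set (suc ℓ)
Subset {ℓ} X = X → Set ℓ

_⇔'_ : Set ℓ → Set ℓ → Set ℓ
P ⇔' Q = (P → Q) × (Q → P)

_⊚_ : {X Y Z : Set ℓ} → BRel Y Z → BRel X Y → BRel X Z
(s ⊚ r) x z = ∃[ y ] (r x y × s y z)

_≐_ : {X Y : Set ℓ} → BRel X Y → BRel X Y → Set ℓ
r ≐ s = ∀ x y → r x y ⇔' s x y

record RawPx ℓ : Set (suc ℓ) where
  field
    Car : Set ℓ
    _≤_ : BRel Car Car
    _≺_ : BRel Car Car
  -- the poset equality (poset reflection of the preorder ≤)
  _≈_ : BRel Car Car
  a ≈ b = (a ≤ b) × (b ≤ a)

⟨_⟩ : RawPx ℓ → Set ℓ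
⟨ S ⟩ = RawPx.Car S

module _ (S : RawPx ℓ) where
  open RawPx S

  record IsRoundedIdeal (I : Subset Car) : Set ℓ where
    field
      down      : ∀ {x y} → x ≤ y → I y → I x
      inhabited : ∃[ x ] I x
      directed  : ∀ {x y} → I x → I y → ∃[ z ] (I z × x ≤ z × y ≤ z)
      rounded   : ∀ x → I x ⇔' (∃[ y ] (x ≺ y × I y))

  record IsRoundedUpper (U : Subset Car) : Set ℓ where
    field
      up      : ∀ {x y} → x ≤ y → U x → U y
      rounded : ∀ x → U x ⇔' (∃[ y ] (y ≺ x × U y))

record IsApproximable (S T : RawPx ℓ) (r : BRel ⟨ S ⟩ ⟨ T ⟩) : Set ℓ where
  field
    ideal : ∀ b → IsRoundedIdeal S (λ a → r a b)
    upper : ∀ a → IsRoundedUpper T (r a)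

record ProximityPoset ℓ : Set (suc ℓ) where
  field
    raw : RawPx ℓ
  open RawPx raw public
  field
    ≤-refl  : ∀ {a} → a ≤ a
    ≤-trans : ∀ {a b c} → a ≤ b → b ≤ c → a ≤ c
    ≺-ideal : ∀ a → IsRoundedIdeal raw (λ b → b ≺ a)
    ≺-upper : ∀ a → IsRoundedUpper raw (λ b → a ≺ b)

record LSPxJLatObj ℓ : Set (suc ℓ) where
  field
    px : ProximityPoset ℓ
  open ProximityPoset px public
  field
    𝟎       : Car
    _∨_     : Car → Car → Car
    𝟎-least : ∀ a → 𝟎 ≤ a
    ∨-ub₁   : ∀ a b → a ≤ (a ∨ b)
    ∨-ub₂   : ∀ a b → b ≤ (a ∨ b)
    ∨-lub   : ∀ {a b c} → a ≤ c → b ≤ c → (a ∨ b) ≤ c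
    strong-𝟎 : ∀ {a} → a ≺ 𝟎 → a ≈ 𝟎
    strong-∨ : ∀ {a b c} → a ≺ (b ∨ c) →
               ∃[ b' ] ∃[ c' ] (a ≤ (b' ∨ c') × b' ≺ b × c' ≺ c)
    localized : ∀ {a b c d} → a ≺ b → b ≤ (c ∨ d) →
                ∃[ a₁ ] ∃[ a₂ ] (a₁ ≺ b × a₁ ≺ c × a₂ ≺ b × a₂ ≺ d × a ≺ (a₁ ∨ a₂))

module _ (S T : LSPxJLatObj ℓ) where
  private
    module S = LSPxJLatObj S
    module T = LSPxJLatObj T

  record IsProximityRelation (r : BRel S.Car T.Car) : Set ℓ where
    field
      approximable : IsApproximable S.raw T.raw r
      join-𝟎   : ∀ {a} → r a T.𝟎 → a S.≈ S.𝟎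
      join-∨   : ∀ {a b c} → r a (b T.∨ c) →
                 ∃[ b' ] ∃[ c' ] (a S.≤ (b' S.∨ c') × r b' b × r c' c)
      lawson-i  : ∀ {a a'} → a S.≺ a' → ∃[ b ] r a b
      lawson-ii : ∀ {a a' b c} → a S.≺ a' → r a' b → r a' c →
                  ∃[ d ] (d T.≺ b × d T.≺ c × r a d)

-- Lower / upper liftings of relations to finitely enumerable subsets
-- (finitely enumerable subsets are represented by enumerating lists)

_ᴸ : {X Y : Set ℓ} → BRel X Y → BRel (List X) (List Y)
(r ᴸ) A B = ∀ a → a ∈ A → ∃[ b ] (b ∈ B × r a b)

_ᵁ : {X Y : Set ℓ} → BRel X Y → BRel (List X) (List Y)
(r ᵁ) A B = ∀ b → b ∈ B → ∃[ a ] (a ∈ A × r a b)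

-- P_L and P_U on raw data (poset reflection = preorder with induced ≈)
PL : RawPx ℓ → RawPx ℓ
PL S = record { Car = List ⟨ S ⟩ ; _≤_ = RawPx._≤_ S ᴸ ; _≺_ = RawPx._≺_ S ᴸ }

PU : RawPx ℓ → RawPx ℓ
PU S = record { Car = List ⟨ S ⟩ ; _≤_ = RawPx._≤_ S ᵁ ; _≺_ = RawPx._≺_ S ᵁ }

module _ (S : RawPx ℓ) where
  open RawPx S

  εL : BRel (List Car) Car
  εL A a = (_≺_ ᴸ) A [ a ]

  εU : BRel (List Car) Car
  εU A a = (_≺_ ᵁ) A [ a ]

  νL : BRel (List Car) (List (List Car))
  νL A 𝒰 = (_≺_ ᴸ) A (concat 𝒰)

  νU : BRel (List Car) (List (List Car))
  νU A 𝒰 = (_≺_ ᵁ) A (concat 𝒰)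

-- 𝒰* : ∅* = {∅}, (𝒰 ∪ {A})* = { B ∪ C | B ∈ 𝒰*, C ∈ Fin⁺(A) }  (as a subset)
_* : {X : Set ℓ} → List (List X) → Subset (List X)
([] *) B = B ≡ []
((A ∷ 𝒰) *) B =
  ∃[ B' ] ∃[ C ] ((𝒰 *) B' × (∃[ c ] (c ∈ C)) × All (_∈ A) C × B ≡ B' ++ C)

-- σ_S : P_U P_L S → P_L P_U S,  𝒰 σ 𝒱 ⇔ 𝒰 (≺_L)_U 𝒱*
σ : (S : RawPx ℓ) → BRel (List (List ⟨ S ⟩)) (List (List ⟨ S ⟩))
σ S 𝒰 𝒱 = ∀ B → (𝒱 *) B → ∃[ A ] (A ∈ 𝒰 × (RawPx._≺_ S ᴸ) A B)

H : RawPx ℓ → RawPx ℓ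
H S = PU (PL S)

Hmap : {S T : RawPx ℓ} → BRel ⟨ S ⟩ ⟨ T ⟩ → BRel ⟨ H S ⟩ ⟨ H T ⟩
Hmap r = (r ᴸ) ᵁ

counitH : (S : RawPx ℓ) → BRel ⟨ H S ⟩ ⟨ S ⟩
counitH S = εU S ⊚ (εL S ᵁ)

comultH : (S : RawPx ℓ) → BRel ⟨ H S ⟩ ⟨ H (H S) ⟩
comultH S = (σ (PL S) ᵁ) ⊚ (νU (PL (PL S)) ⊚ (νL S ᵁ))

record Coalg ℓ : Set (suc ℓ) where
  field
    obj      : ProximityPoset ℓ
  open ProximityPoset obj public
  field
    α        : BRel Car ⟨ H raw ⟩
    α-approx : IsApproximable raw (H raw) α
    counit-law : (counitH raw ⊚ α) ≐ _≺_
    coassoc    : (comultH raw ⊚ α) ≐ (Hmap {S = raw} {T = H raw} α ⊚ α)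

record IsCoalgHom (X Y : Coalg ℓ) (f : BRel ⟨ Coalg.raw X ⟩ ⟨ Coalg.raw Y ⟩) : Set ℓ where
  field
    approximable : IsApproximable (Coalg.raw X) (Coalg.raw Y) f
    commutes     : (Hmap {S = Coalg.raw X} {T = Coalg.raw Y} f ⊚ Coalg.α X)
                     ≐ (Coalg.α Y ⊚ f)

-- Categories whose objects carry raw proximity data, morphisms are
-- relations satisfying a property, identity = ≺, composition = relational
-- composition, equality of morphisms = equality of relations.

record ConcreteCat ℓ : Set (suc (suc ℓ)) where
  field
    Obj     : Set (suc ℓ)
    carrier : Obj → RawPx ℓ
    IsHom   : (A B : Obj) → BRel ⟨ carrier A ⟩ ⟨ carrier B ⟩ → Set ℓ
  Ob : Obj → Set ℓ
  Ob A = ⟨ carrier A ⟩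
  idRel : (A : Obj) → BRel (Ob A) (Ob A)
  idRel A = RawPx._≺_ (carrier A)

LSPxJLat : ∀ ℓ → ConcreteCat ℓ
LSPxJLat ℓ = record
  { Obj = LSPxJLatObj ℓ
  ; carrier = LSPxJLatObj.raw
  ; IsHom = IsProximityRelation
  }

CoalgH : ∀ ℓ → ConcreteCat ℓ
CoalgH ℓ = record
  { Obj = Coalg ℓ
  ; carrier = Coalg.raw
  ; IsHom = IsCoalgHom
  }

record Functor (C D : ConcreteCat ℓ) : Set (suc ℓ) where
  private
    module C = ConcreteCat C
    module D = ConcreteCat D
  field
    F₀     : C.Obj → D.Obj
    F₁     : ∀ {A B} (r : BRel (C.Ob A) (C.Ob B)) → C.IsHom A B r →
             BRel (D.Ob (F₀ A)) (D.Ob (F₀ B))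
    F₁-hom : ∀ {A B} r (p : C.IsHom A B r) → D.IsHom (F₀ A) (F₀ B) (F₁ r p)
    F-resp : ∀ {A B} {r s : BRel (C.Ob A) (C.Ob B)} (p : C.IsHom A B r) (q : C.IsHom A B s) →
             r ≐ s → F₁ r p ≐ F₁ s q
    F-id   : ∀ A (p : C.IsHom A A (C.idRel A)) → F₁ (C.idRel A) p ≐ D.idRel (F₀ A)
    F-comp : ∀ {A B E} (r : BRel (C.Ob A) (C.Ob B)) (s : BRel (C.Ob B) (C.Ob E))
             (p : C.IsHom A B r) (q : C.IsHom B E s) (pq : C.IsHom A E (s ⊚ r)) →
             F₁ (s ⊚ r) pq ≐ (F₁ s q ⊚ F₁ r p)

record Equivalence (C D : ConcreteCat ℓ) : Set (suc ℓ) where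
  private
    module C = ConcreteCat C
    module D = ConcreteCat D
  field
    F : Functor C D
    G : Functor D C
  private
    module F = Functor F
    module G = Functor G
  field
    η      : ∀ A → BRel (C.Ob A) (C.Ob (G.F₀ (F.F₀ A)))
    η-hom  : ∀ A → C.IsHom A (G.F₀ (F.F₀ A)) (η A)
    η⁻     : ∀ A → BRel (C.Ob (G.F₀ (F.F₀ A))) (C.Ob A)
    η⁻-hom : ∀ A → C.IsHom (G.F₀ (F.F₀ A)) A (η⁻ A)
    η-iso₁ : ∀ A → (η⁻ A ⊚ η A) ≐ C.idRel A
    η-iso₂ : ∀ A → (η A ⊚ η⁻ A) ≐ C.idRel (G.F₀ (F.F₀ A))
    η-nat  : ∀ {A B} (r : BRel (C.Ob A) (C.Ob B)) (p : C.IsHom A B r) →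
             (G.F₁ (F.F₁ r p) (F.F₁-hom r p) ⊚ η A) ≐ (η B ⊚ r)
    ε      : ∀ X → BRel (D.Ob (F.F₀ (G.F₀ X))) (D.Ob X)
    ε-hom  : ∀ X → D.IsHom (F.F₀ (G.F₀ X)) X (ε X)
    ε⁻     : ∀ X → BRel (D.Ob X) (D.Ob (F.F₀ (G.F₀ X)))
    ε⁻-hom : ∀ X → D.IsHom X (F.F₀ (G.F₀ X)) (ε⁻ X)
    ε-iso₁ : ∀ X → (ε⁻ X ⊚ ε X) ≐ D.idRel (F.F₀ (G.F₀ X))
    ε-iso₂ : ∀ X → (ε X ⊚ ε⁻ X) ≐ D.idRel X
    ε-nat  : ∀ {X Y} (r : BRel (D.Ob X) (D.Ob Y)) (p : D.IsHom X Y r) →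
             (r ⊚ ε X) ≐ (ε Y ⊚ F.F₁ (G.F₁ r p) (G.F₁-hom r p))

{-# OPTIONS --safe #-}
-- Approximable relations S → T are the Scott continuous maps Idl T → Idl S between
-- ideal completions, so a coalgebra of H is a continuous domain with an algebra
-- structure for the free-frame monad, that is, a continuous frame.  From frames to
-- coalgebras, take a α 𝒰 to mean a ≪ ⋀_{A ∈ 𝒰} ⋁ A; localization gives the
-- distributivity expressed by coassociativity.  Conversely α is determined by the
-- relation a α {A} ("a ≪ ⋁ A"), and finite lists of elements of the coalgebra, ordered
-- through this relation, form a localized strong proximity ∨-semilattice.  The passage
-- from frames to coalgebras is the identity on morphisms, is full, and every coalgebra
-- is isomorphic to the one presented by its lists; the inverse functor is conjugation by
-- these isomorphisms.
module Submission where

open import Defs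
open import Level using (Level)
open import Data.List using (List; []; _∷_; _++_; [_]; concat; map; foldr; cartesianProductWith)
open import Data.List.Properties using (concat-map-[_])
open import Data.List.Membership.Propositional using (_∈_)
open import Data.List.Membership.Propositional.Properties
  using (∈-++⁺ˡ; ∈-++⁺ʳ; ∈-++⁻; ∈-concat⁺′; ∈-concat⁻′; ∈-map⁺; ∈-map⁻;
         ∈-cartesianProductWith⁺; ∈-cartesianProductWith⁻)
open import Data.List.Relation.Binary.Subset.Propositional using (_⊆_)
open import Data.List.Relation.Unary.All using ([]; _∷_) renaming (lookup to All-lookup)
open import Data.List.Relation.Unary.Any using (here; there)
open import Data.Product using (∃-syntax; _×_; _,_; proj₁; proj₂)
open import Data.Sum using (_⊎_; inj₁; inj₂)
open import Function using (id; _∘_)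
open import Relation.Binary.PropositionalEquality using (refl; sym; subst)

private variable ℓ : Level

-- Liftings of relations to lists, and choices from finite families.

infix 4 _⊑_
_⊑_ : {X Y : Set ℓ} → BRel X Y → BRel X Y → Set ℓ
r ⊑ s = ∀ {x y} → r x y → s x y

-- Finite choice. Both liftings are kept: the lower one finds a witness for each `x`, the upper one
-- guarantees that `B` holds nothing but witnesses.
collect : {X Y : Set ℓ} (r : BRel X Y) (A : List X) → (∀ x → x ∈ A → ∃[ y ] r x y) →
          ∃[ B ] ((r ᴸ) A B × (r ᵁ) A B)
collect r [] _ = [] , (λ _ ()) , (λ _ ())
collect r (x ∷ A) h with h x (here refl) | collect r A (λ x' i → h x' (there i))
... | y , rxy | B , f , g = y ∷ B , f' , g'
  where
  f' : (r ᴸ) (x ∷ A) (y ∷ B)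
  f' _ (here refl) = y , here refl , rxy
  f' a (there i) with f a i
  ... | b , j , p = b , there j , p
  g' : (r ᵁ) (x ∷ A) (y ∷ B)
  g' _ (here refl) = x , here refl , rxy
  g' b (there j) with g b j
  ... | a , i , p = a , there i , p

module _ {X Y Z : Set ℓ} {r : BRel X Y} {s : BRel Y Z} {t : BRel X Z} where

  -- The collected midpoints carry both halves of the factorisation, so one list serves as target of
  -- `r` and as source of `s`.
  ᴸ-factor : t ⊑ (s ⊚ r) → (t ᴸ) ⊑ ((s ᴸ) ⊚ (r ᴸ))
  ᴸ-factor h {A} {C} tAC with
    collect (λ x y → r x y × ∃[ z ] (z ∈ C × s y z)) A
      (λ x i → let (z , j , p) = tAC x i ; (y , q , q') = h p in y , q , z , j , q')
  ... | B , f , g =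
    B , (λ a i → let (b , j , p , _) = f a i in b , j , p) ,
        (λ b j → let (_ , _ , _ , q) = g b j in q)

  ᴸ-merge : (s ⊚ r) ⊑ t → ((s ᴸ) ⊚ (r ᴸ)) ⊑ (t ᴸ)
  ᴸ-merge h (B , f , g) a i =
    let (b , j , p) = f a i ; (c , k , q) = g b j in c , k , h (b , p , q)

  ᵁ-factor : t ⊑ (s ⊚ r) → (t ᵁ) ⊑ ((s ᵁ) ⊚ (r ᵁ))
  ᵁ-factor h {A} {C} tAC with
    collect (λ z y → s y z × ∃[ x ] (x ∈ A × r x y)) C
      (λ z i → let (x , j , p) = tAC z i ; (y , q , q') = h p in y , q' , x , j , q)
  ... | B , f , g =
    B , (λ b j → let (_ , _ , _ , q) = g b j in q) ,
        (λ c i → let (b , j , p , _) = f c i in b , j , p)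

  ᵁ-merge : (s ⊚ r) ⊑ t → ((s ᵁ) ⊚ (r ᵁ)) ⊑ (t ᵁ)
  ᵁ-merge h (B , f , g) c k =
    let (b , j , q) = g c k ; (a , i , p) = f b j in a , i , h (b , p , q)

-- A finite cofinal part of `𝒰 *`, which in general has infinitely many lists because of
-- repetitions. One element per member of `𝒰` is enough wherever a condition on `B` is inherited by
-- larger lists.
choices : {X : Set ℓ} → List (List X) → List (List X)
choices []      = [ [] ]
choices (A ∷ 𝒰) = cartesianProductWith (λ B c → B ++ [ c ]) (choices 𝒰) A

choices⊆* : {X : Set ℓ} (𝒰 : List (List X)) {B : List X} → B ∈ choices 𝒰 → (𝒰 *) B
choices⊆* [] (here refl) = refl
choices⊆* (A ∷ 𝒰) i with ∈-cartesianProductWith⁻ (λ B c → B ++ [ c ]) (choices 𝒰) A i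
... | B , c , j , k , refl = B , [ c ] , choices⊆* 𝒰 j , (c , here refl) , k ∷ [] , refl

*-refines-choices : {X : Set ℓ} (𝒰 : List (List X)) {B : List X} → (𝒰 *) B →
                    ∃[ B' ] (B' ∈ choices 𝒰 × B' ⊆ B)
*-refines-choices [] refl = [] , here refl , id
*-refines-choices (A ∷ 𝒰) (B , C , B∈ , (c , c∈C) , C⊆A , refl)
  with *-refines-choices 𝒰 B∈
... | B' , j , sub =
  B' ++ [ c ] , ∈-cartesianProductWith⁺ (λ B c → B ++ [ c ]) j (All-lookup C⊆A c∈C) ,
  λ i → lem (∈-++⁻ B' i)
  where
  lem : ∀ {x} → x ∈ B' ⊎ x ∈ [ c ] → x ∈ B ++ C
  lem (inj₁ i) = ∈-++⁺ˡ (sub i)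
  lem (inj₂ (here refl)) = ∈-++⁺ʳ B c∈C

*-meets : {X : Set ℓ} (𝒰 : List (List X)) {A B : List X} → A ∈ 𝒰 → (𝒰 *) B →
          ∃[ x ] (x ∈ A × x ∈ B)
*-meets (A ∷ 𝒰) (here refl) (B , C , B∈ , (c , c∈C) , C⊆A , refl) =
  c , All-lookup C⊆A c∈C , ∈-++⁺ʳ B c∈C
*-meets (A ∷ 𝒰) (there i) (B , C , B∈ , _ , _ , refl) with *-meets 𝒰 i B∈
... | x , j , k = x , j , ∈-++⁺ˡ k

split-list : {X : Set ℓ} {P Q : Subset X} (A : List X) → (∀ a → a ∈ A → P a ⊎ Q a) →
  ∃[ B ] ∃[ D ] (A ⊆ B ++ D × (∀ b → b ∈ B → P b) × (∀ d → d ∈ D → Q d))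
split-list [] h = [] , [] , id , (λ _ ()) , (λ _ ())
split-list (a ∷ A) h with h a (here refl) | split-list A (λ x i → h x (there i))
... | inj₁ p | B , D , sub , f , g =
  a ∷ B , D , (λ { (here refl) → here refl ; (there i) → there (sub i) }) ,
  (λ { _ (here refl) → p ; b (there i) → f b i }) , g
... | inj₂ q | B , D , sub , f , g =
  B , a ∷ D ,
  (λ { (here refl) → ∈-++⁺ʳ B (here refl) ; (there i) → shift (∈-++⁻ B (sub i)) }) ,
  f , (λ { _ (here refl) → q ; b (there i) → g b i })
  where
  shift : ∀ {x} → x ∈ B ⊎ x ∈ D → x ∈ B ++ a ∷ D
  shift (inj₁ i) = ∈-++⁺ˡ i
  shift (inj₂ i) = ∈-++⁺ʳ B (there i)

-- Proximity posets, and the comultiplication up to interpolation.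

module PxProperties (P : ProximityPoset ℓ) where
  open ProximityPoset P
  private
    module Id a = IsRoundedIdeal (≺-ideal a)
    module Up a = IsRoundedUpper (≺-upper a)

  ≺-interpolate : _≺_ ⊑ (_≺_ ⊚ _≺_)
  ≺-interpolate {a} {b} = proj₁ (Id.rounded b a)

  ≺-compose : (_≺_ ⊚ _≺_) ⊑ _≺_
  ≺-compose {a} {b} = proj₂ (Id.rounded b a)

  ≺-trans : ∀ {a b c} → a ≺ b → b ≺ c → a ≺ c
  ≺-trans p q = ≺-compose (_ , p , q)

  ≤-≺-trans : ∀ {a b c} → a ≤ b → b ≺ c → a ≺ c
  ≤-≺-trans {c = c} = Id.down c

  ≺-≤-trans : ∀ {a b c} → a ≺ b → b ≤ c → a ≺ c
  ≺-≤-trans {a} p q = Up.up a q p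

  infix 4 _≺ᴸ_ _≺ᴸᵁ_
  _≺ᴸ_ : BRel (List Car) (List Car)
  _≺ᴸ_ = _≺_ ᴸ
  _≺ᴸᵁ_ : BRel (List (List Car)) (List (List Car))
  _≺ᴸᵁ_ = (_≺_ ᴸ) ᵁ

  ≺ᴸ-interpolate : _≺ᴸ_ ⊑ (_≺ᴸ_ ⊚ _≺ᴸ_)
  ≺ᴸ-interpolate = ᴸ-factor ≺-interpolate

  ≺ᴸ-trans : ∀ {A B C} → A ≺ᴸ B → B ≺ᴸ C → A ≺ᴸ C
  ≺ᴸ-trans p q = ᴸ-merge ≺-compose (_ , p , q)

  ⊆⇒≤ᴸ : ∀ {A B : List Car} → A ⊆ B → (_≤_ ᴸ) A B
  ⊆⇒≤ᴸ sub a i = a , sub i , ≤-refl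

  ≺ᴸ-⊆ : ∀ {A B C} → A ≺ᴸ B → B ⊆ C → A ≺ᴸ C
  ≺ᴸ-⊆ h sub a i = let (b , j , p) = h a i in b , sub j , p

  ≺ᴸ-concat : ∀ {A 𝒱 𝒲} → A ≺ᴸ concat 𝒱 → (_≺ᴸ_ ᴸ) 𝒱 𝒲 → A ≺ᴸ concat 𝒲
  ≺ᴸ-concat {𝒱 = 𝒱} p q a i with p a i
  ... | b , j , a≺b with ∈-concat⁻′ 𝒱 j
  ... | V , b∈V , V∈𝒱 with q V V∈𝒱
  ... | W , W∈𝒲 , V≺W with V≺W b b∈V
  ... | c , c∈W , b≺c = c , ∈-concat⁺′ c∈W W∈𝒲 , ≺-trans a≺b b≺c

  ≺ᴸ-concat-interpolate : ∀ {A 𝒲} → A ≺ᴸ concat 𝒲 →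
    ∃[ 𝒱 ] (A ≺ᴸ concat 𝒱 × (_≺ᴸ_ ᴸ) 𝒱 𝒲)
  ≺ᴸ-concat-interpolate {A} {𝒲} p with ≺ᴸ-interpolate {A} {concat 𝒲} p
  ... | B , A≺B , B≺ =
    -- Each interpolant gets a block of its own, so that it can be matched with the member of `𝒲`
    -- holding an element above it.
    map [_] B , subst (A ≺ᴸ_) (sym (concat-map-[ B ])) A≺B , below
    where
    below : (_≺ᴸ_ ᴸ) (map [_] B) 𝒲
    below _ i with ∈-map⁻ [_] i
    ... | b , b∈B , refl with B≺ b b∈B
    ... | c , j , b≺c with ∈-concat⁻′ 𝒲 j
    ... | W , c∈W , W∈𝒲 = W , W∈𝒲 , λ { _ (here refl) → c , c∈W , b≺c }

  -- Up to interpolation, comultH 𝒰 𝔚 says that 𝒰 lies below each join of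
  -- meets w ∈ 𝔚 expanded by distributivity into the meet of the joins ⋁⋃B, B ∈ w*.
  Expands : List (List Car) → List (List (List (List Car))) → Set _
  Expands 𝒰 𝔚 = ∀ w → w ∈ 𝔚 → ∀ B → (w *) B → ∃[ A ] (A ∈ 𝒰 × A ≺ᴸ concat B)

  comultH⇒Expands : ∀ {𝒰 𝔚} → comultH raw 𝒰 𝔚 → Expands 𝒰 𝔚
  comultH⇒Expands (𝔛 , (𝒱 , 𝒰ν𝒱 , 𝒱ν𝔛) , 𝔛σ𝔚) w w∈ B B∈w* =
    let (𝒵 , 𝒵∈ , 𝒵σw) = 𝔛σ𝔚 w w∈
        (Z , Z∈ , Z≺B) = 𝒵σw B B∈w*
        (V , V∈ , V≺Z) = 𝒱ν𝔛 Z (∈-concat⁺′ Z∈ 𝒵∈)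
        (A , A∈ , A≺V) = 𝒰ν𝒱 V V∈
    in A , A∈ , ≺ᴸ-concat {𝒱 = Z} {𝒲 = B} (≺ᴸ-concat {𝒱 = V} {𝒲 = Z} A≺V V≺Z) Z≺B

  Interpolates : List (List Car) → BRel (List (List Car)) (List (List Car))
  Interpolates 𝒰 Z V = (_≺ᴸ_ ᴸ) V Z × ∃[ A ] (A ∈ 𝒰 × A ≺ᴸ concat V)

  -- `comultH` composes three relations, so each `A ≺ᴸ concat B` is interpolated twice, first by `Z`
  -- and then by `V`. The `Z` are gathered, for each `w`, into `𝔛`, and the `V` into `𝒱`. Treating
  -- `choices w` suffices, since every `B` in `w *` contains one of these.
  Expands⇒comultH : ∀ {𝒰 𝔚} → Expands 𝒰 𝔚 → comultH raw 𝒰 𝔚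
  Expands⇒comultH {𝒰} {𝔚} h with
      collect expansion 𝔚 (λ w w∈ → expand w w∈)
    where
    Approximant : BRel (List (List Car)) (List (List Car))
    Approximant B Z = (_≺ᴸ_ ᴸ) Z B × ∃[ V ] Interpolates 𝒰 Z V
    expansion : BRel (List (List (List Car))) (List (List (List Car)))
    expansion w 𝒵 = (Approximant ᴸ) (choices w) 𝒵 × (Approximant ᵁ) (choices w) 𝒵
    expand : ∀ w → w ∈ 𝔚 → ∃[ 𝒵 ] expansion w 𝒵
    expand w w∈ = collect Approximant (choices w) λ B B∈ →
      let (A , A∈ , A≺) = h w w∈ B (choices⊆* w B∈)
          (Z , A≺Z , Z≺B) = ≺ᴸ-concat-interpolate {A} {B} A≺
          (V , A≺V , V≺Z) = ≺ᴸ-concat-interpolate {A} {Z} A≺Z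
      in Z , Z≺B , V , V≺Z , A , A∈ , A≺V
  ... | 𝔛 , f , g with collect (Interpolates 𝒰) (concat 𝔛) interpolant
    where
    interpolant : ∀ Z → Z ∈ concat 𝔛 → ∃[ V ] Interpolates 𝒰 Z V
    interpolant Z i =
      let (𝒵 , Z∈ , 𝒵∈) = ∈-concat⁻′ 𝔛 i
          (w , w∈ , _ , back) = g 𝒵 𝒵∈
          (_ , _ , _ , V) = back Z Z∈
      in V
  ... | 𝒱 , f' , g' = 𝔛 , (𝒱 , 𝒰ν𝒱 , 𝒱ν𝔛) , 𝔛σ𝔚
    where
    𝒰ν𝒱 : (νL raw ᵁ) 𝒰 𝒱
    𝒰ν𝒱 V V∈ = let (_ , _ , _ , A) = g' V V∈ in A
    𝒱ν𝔛 : νU (PL (PL raw)) 𝒱 𝔛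
    𝒱ν𝔛 Z Z∈ = let (V , V∈ , V≺Z , _) = f' Z Z∈ in V , V∈ , V≺Z
    𝔛σ𝔚 : (σ (PL raw) ᵁ) 𝔛 𝔚
    𝔛σ𝔚 w w∈ = let (𝒵 , 𝒵∈ , forth , _) = f w w∈ in 𝒵 , 𝒵∈ , λ B B∈ →
      let (B' , B'∈ , B'⊆B) = *-refines-choices w B∈
          (Z , Z∈ , Z≺B' , _) = forth B' B'∈
      in Z , Z∈ , λ z z∈ → let (b , b∈ , p) = Z≺B' z z∈ in b , B'⊆B b∈ , p

-- Entailment calculus of a coalgebra.

module CoalgProperties (C : Coalg ℓ) where
  open Coalg C
  open PxProperties obj public
  private
    module Ideal 𝒰 = IsRoundedIdeal (IsApproximable.ideal α-approx 𝒰)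
    module Upper a = IsRoundedUpper (IsApproximable.upper α-approx a)

  α-round : ∀ {a 𝒰} → α a 𝒰 → ∃[ b ] (a ≺ b × α b 𝒰)
  α-round = proj₁ (Ideal.rounded _ _)

  α-refine : ∀ {a 𝒰} → α a 𝒰 → ∃[ 𝒱 ] (𝒱 ≺ᴸᵁ 𝒰 × α a 𝒱)
  α-refine = proj₁ (Upper.rounded _ _)

  α-coarsen : ∀ {a 𝒰 𝒱} → 𝒱 ≺ᴸᵁ 𝒰 → α a 𝒱 → α a 𝒰
  α-coarsen p q = proj₂ (Upper.rounded _ _) (_ , p , q)

  α-⊆ : ∀ {a A B} → α a [ A ] → A ⊆ B → α a [ B ]
  α-⊆ {A = A} p sub = Upper.up _ (λ { _ (here refl) → A , here refl , ⊆⇒≤ᴸ sub }) p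

  α-component : ∀ {a 𝒰 A} → α a 𝒰 → A ∈ 𝒰 → α a [ A ]
  α-component {A = A} p i = Upper.up _ (λ { _ (here refl) → A , i , ⊆⇒≤ᴸ id }) p

  α-upper-bound : ∀ {𝒰} (A : List Car) → (∀ a → a ∈ A → α a 𝒰) →
                  ∃[ b ] (α b 𝒰 × (∀ a → a ∈ A → a ≤ b))
  α-upper-bound {𝒰} [] h = let (b , p) = Ideal.inhabited 𝒰 in b , p , λ _ ()
  α-upper-bound {𝒰} (a ∷ A) h =
    let (b , p , A≤b) = α-upper-bound {𝒰} A (λ x i → h x (there i))
        (c , q , a≤c , b≤c) = Ideal.directed 𝒰 (h a (here refl)) p
    in c , q , λ { _ (here refl) → a≤c ; x (there i) → ≤-trans (A≤b x i) b≤c }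

  ≺⇒α : ∀ {a b} → a ≺ b → α a [ [ b ] ]
  ≺⇒α {a} {b} p with proj₂ (counit-law a b) p
  ... | 𝒰 , a⊢𝒰 , W , 𝒰εW , Wεb with Wεb b (here refl)
  ... | w , w∈W , w≺b with 𝒰εW w w∈W
  ... | A , A∈𝒰 , A≺w = α-coarsen {𝒱 = 𝒰} A≺b a⊢𝒰
    where
    A≺b : 𝒰 ≺ᴸᵁ [ [ b ] ]
    A≺b _ (here refl) = A , A∈𝒰 , ≺ᴸ-trans {B = [ w ]} A≺w λ { _ (here refl) → b , here refl , w≺b }

  -- The counit wants one element between a member of the refined family and `b`, while
  -- interpolation yields a list; directedness of the ideal below `b` merges that list into `c`.
  α⇒≺ : ∀ {a b} → α a [ [ b ] ] → a ≺ b
  α⇒≺ {a} {b} p with α-refine p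
  ... | 𝒰 , 𝒰≺ , a⊢𝒰 with 𝒰≺ [ b ] (here refl)
  ... | A , A∈𝒰 , A≺b with ≺ᴸ-interpolate {A} {[ b ]} A≺b
  ... | B , A≺B , B≺b with α-upper b B B≺b
    where
    α-upper : ∀ b B → B ≺ᴸ [ b ] → ∃[ c ] (c ≺ b × (∀ x → x ∈ B → x ≤ c))
    α-upper b [] h = let (c , p) = IsRoundedIdeal.inhabited (≺-ideal b) in c , p , λ _ ()
    α-upper b (x ∷ B) h with h x (here refl) | α-upper b B (λ y i → h y (there i))
    ... | _ , here refl , x≺b | c , c≺b , B≤c =
      let (d , d≺b , x≤d , c≤d) = IsRoundedIdeal.directed (≺-ideal b) x≺b c≺b
      in d , d≺b , λ { _ (here refl) → x≤d ; y (there i) → ≤-trans (B≤c y i) c≤d }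
  ... | c , c≺b , B≤c = proj₁ (counit-law a b)
    (𝒰 , a⊢𝒰 , [ c ] ,
     (λ { _ (here refl) → A , A∈𝒰 , λ x i →
          let (y , j , x≺y) = A≺B x i in c , here refl , ≺-≤-trans x≺y (B≤c y j) }) ,
     (λ { _ (here refl) → c , here refl , c≺b }))

  -- This half of coassociativity is the source of transitivity (`α-cut`); the converse half,
  -- `α-collapse`, is the source of distributivity (`α-distribute`).
  α-expand : ∀ {a 𝒰} 𝔚 → α a 𝒰 → Hmap {S = raw} {T = H raw} α 𝒰 𝔚 →
             ∃[ 𝒱 ] (α a 𝒱 × Expands 𝒱 𝔚)
  α-expand {a} {𝒰} 𝔚 p q = let (𝒱 , r , c) = proj₂ (coassoc a 𝔚) (𝒰 , p , q)
                           in 𝒱 , r , comultH⇒Expands {𝒱} c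

  α-collapse : ∀ {a 𝒱} 𝔚 → α a 𝒱 → Expands 𝒱 𝔚 →
               ∃[ 𝒰 ] (α a 𝒰 × Hmap {S = raw} {T = H raw} α 𝒰 𝔚)
  α-collapse {a} {𝒱} 𝔚 p q = proj₁ (coassoc a 𝔚) (𝒱 , p , Expands⇒comultH {𝒱} q)

  -- The nested family for `B` is `[ [ B ] ]`, a join of one meet of one join. Distributing it
  -- changes nothing, so coassociativity reduces to composition of entailments.
  α-cut : ∀ {a 𝒰 𝒱} → α a 𝒰 →
          (∀ B → B ∈ 𝒱 → ∃[ A ] (A ∈ 𝒰 × (∀ x → x ∈ A → α x [ B ]))) → α a 𝒱
  α-cut {a} {𝒰} {𝒱} a⊢𝒰 h =
    let (𝒲 , a⊢𝒲 , e) = α-expand 𝔚 a⊢𝒰 below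
    in α-coarsen {𝒱 = 𝒲} (above e) a⊢𝒲
    where
    𝔚 : List (List (List (List Car)))
    𝔚 = map (λ B → [ [ B ] ]) 𝒱
    below : Hmap {S = raw} {T = H raw} α 𝒰 𝔚
    below _ i with ∈-map⁻ (λ B → [ [ B ] ]) i
    ... | B , B∈𝒱 , refl with h B B∈𝒱
    ... | A , A∈𝒰 , p = A , A∈𝒰 , λ x j → [ B ] , here refl , p x j
    ++-[]⊆ : ∀ {B : List Car} → B ++ [] ⊆ B
    ++-[]⊆ {B} i with ∈-++⁻ B i
    ... | inj₁ j = j
    above : ∀ {𝒲} → Expands 𝒲 𝔚 → 𝒲 ≺ᴸᵁ 𝒱
    above e B B∈𝒱 =
      let (A , A∈ , A≺) = e [ [ B ] ] (∈-map⁺ (λ B → [ [ B ] ]) B∈𝒱) [ B ]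
                            ([] , [ B ] , refl , (B , here refl) , here refl ∷ [] , refl)
      in A , A∈ , ≺ᴸ-⊆ {A} A≺ ++-[]⊆

  α-bind : ∀ {a A B} → α a [ A ] → (∀ x → x ∈ A → α x [ B ]) → α a [ B ]
  α-bind {A = A} p h = α-cut p λ { _ (here refl) → A , here refl , h }

  -- The gap `a ≺ b` places `a` under the singleton `[ b ]`, a single premise from which the cut
  -- derives all members of `𝒰` together.
  α-meet : ∀ {a b 𝒰} → a ≺ b → (∀ A → A ∈ 𝒰 → α b [ A ]) → α a 𝒰
  α-meet {b = b} p h = α-cut (≺⇒α p) λ A i → [ b ] , here refl , λ { _ (here refl) → h A i }

  -- `w` is the formal join of the meets `B ∧ D` and `B ∧ E`. A choice from it contains `B`, or else
  -- both `D` and `E`, so its union includes `B` or `D ++ E`. Hence the hypothesis expands `w`, and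
  -- `α-collapse` returns a cover each of whose elements lies under one of the two meets.
  α-distribute : ∀ {a} B D E → α a (B ∷ (D ++ E) ∷ []) →
    ∃[ A ] (α a [ A ] × (∀ x → x ∈ A → α x (B ∷ D ∷ []) ⊎ α x (B ∷ E ∷ [])))
  α-distribute {a} B D E p =
    let (𝒱 , 𝒱≺ , a⊢𝒱) = α-refine p
    in finish (α-collapse [ w ] a⊢𝒱 (expands 𝒱≺))
    where
    w : List (List (List Car))
    w = (B ∷ D ∷ []) ∷ (B ∷ E ∷ []) ∷ []
    expands : ∀ {𝒱} → 𝒱 ≺ᴸᵁ (B ∷ (D ++ E) ∷ []) → Expands 𝒱 [ w ]
    expands {𝒱} 𝒱≺ _ (here refl) 𝒞 𝒞∈w* =
      choose (*-meets w (here refl) 𝒞∈w*) (*-meets w (there (here refl)) 𝒞∈w*)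
      where
      B-in : B ∈ 𝒞 → ∃[ A ] (A ∈ 𝒱 × A ≺ᴸ concat 𝒞)
      B-in B∈ = let (A , A∈ , A≺B) = 𝒱≺ B (here refl)
                in A , A∈ , ≺ᴸ-⊆ A≺B λ i → ∈-concat⁺′ i B∈
      DE-in : D ∈ 𝒞 → E ∈ 𝒞 → D ++ E ⊆ concat 𝒞
      DE-in D∈ E∈ i with ∈-++⁻ D i
      ... | inj₁ j = ∈-concat⁺′ j D∈
      ... | inj₂ j = ∈-concat⁺′ j E∈
      choose : ∃[ x ] (x ∈ B ∷ D ∷ [] × x ∈ 𝒞) → ∃[ x ] (x ∈ B ∷ E ∷ [] × x ∈ 𝒞) →
               ∃[ A ] (A ∈ 𝒱 × A ≺ᴸ concat 𝒞)
      choose (_ , here refl , B∈) _ = B-in B∈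
      choose (_ , there (here refl) , _) (_ , here refl , B∈) = B-in B∈
      choose (_ , there (here refl) , D∈) (_ , there (here refl) , E∈) =
        let (A , A∈ , A≺) = 𝒱≺ (D ++ E) (there (here refl))
        in A , A∈ , ≺ᴸ-⊆ A≺ (DE-in D∈ E∈)
    split : ∀ {x} → ∃[ h ] (h ∈ w × α x h) → α x (B ∷ D ∷ []) ⊎ α x (B ∷ E ∷ [])
    split (_ , here refl , r) = inj₁ r
    split (_ , there (here refl) , r) = inj₂ r
    finish : ∃[ 𝒰 ] (α a 𝒰 × Hmap {S = raw} {T = H raw} α 𝒰 [ w ]) →
      ∃[ A ] (α a [ A ] × (∀ x → x ∈ A → α x (B ∷ D ∷ []) ⊎ α x (B ∷ E ∷ [])))
    finish (𝒰 , a⊢𝒰 , below) with below w (here refl)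
    ... | A , A∈𝒰 , q = A , α-component a⊢𝒰 A∈𝒰 , λ x i → split (q x i)

  -- The lattice of lists of a coalgebra.

  infix 4 _≪_ _≼_
  _≪_ : BRel (List Car) (List Car)
  A ≪ B = ∀ a → a ∈ A → α a [ B ]

  -- The second conjunct makes {A ∣ A ≪ C} downward closed: the first one only compares
  -- the ideals of elements way below ⋁ A and ⋁ B, which need not contain A and B.
  _≼_ : BRel (List Car) (List Car)
  A ≼ B = (∀ a → α a [ A ] → α a [ B ]) × (∀ C → B ≪ C → A ≪ C)

  ≪⇒≼ : ∀ {A B} → A ≪ B → A ≼ B
  ≪⇒≼ A≪B = (λ a p → α-bind p A≪B) , (λ C B≪C a i → α-bind (A≪B a i) B≪C)

  ⊆⇒≼ : ∀ {A B} → A ⊆ B → A ≼ B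
  ⊆⇒≼ sub = (λ a p → α-⊆ p sub) , (λ C B≪C a i → B≪C a (sub i))

  ≪-trans : ∀ {A B C} → A ≪ B → B ≪ C → A ≪ C
  ≪-trans p q a i = α-bind (p a i) q

  ≪-⊆ : ∀ {A B C} → A ≪ B → B ⊆ C → A ≪ C
  ≪-⊆ p sub a i = α-⊆ (p a i) sub

  ++-≪ : ∀ {A B C} → A ≪ C → B ≪ C → (A ++ B) ≪ C
  ++-≪ {A} p q a i with ∈-++⁻ A i
  ... | inj₁ j = p a j
  ... | inj₂ j = q a j

  ≺ᴸ⇒≪ : ∀ {A B} → A ≺ᴸ B → A ≪ B
  ≺ᴸ⇒≪ A≺B a i =
    let (b , j , a≺b) = A≺B a i in α-⊆ (≺⇒α a≺b) λ { (here refl) → j }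

  α-interpolate : ∀ {a B} → α a [ B ] → ∃[ A ] (α a [ A ] × A ≺ᴸ B)
  α-interpolate {B = B} p =
    let (𝒱 , 𝒱≺ , q) = α-refine p ; (A , A∈ , A≺B) = 𝒱≺ B (here refl)
    in A , α-component q A∈ , A≺B

  -- The covers of the single elements are pooled by concatenation; `Q` survives because each
  -- element of the pool belongs to one of them.
  ≪-from-pointwise : ∀ {A} (Q : Car → Set ℓ) →
    (∀ a → a ∈ A → ∃[ B ] (α a [ B ] × (∀ b → b ∈ B → Q b))) →
    ∃[ B ] (A ≪ B × (∀ b → b ∈ B → Q b))
  ≪-from-pointwise {A} Q h with collect (λ a B → α a [ B ] × (∀ b → b ∈ B → Q b)) A h
  ... | 𝒰 , f , g = concat 𝒰 ,
    (λ a i → let (B , j , p , _) = f a i in α-⊆ p (λ k → ∈-concat⁺′ k j)) ,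
    (λ b i → let (B , j , k) = ∈-concat⁻′ 𝒰 i ; (_ , _ , _ , q) = g B k in q b j)

  -- The second half says `≺ᴸ` and not just `≪`: every element of `B` then has a named element of
  -- `C` above it, by which `++-strong` sorts `B` into two parts.
  ≪-interpolate : ∀ {A C} → A ≪ C → ∃[ B ] (A ≪ B × B ≺ᴸ C)
  ≪-interpolate {C = C} h =
    ≪-from-pointwise (λ b → ∃[ c ] (c ∈ C × b ≺ c)) λ a i → α-interpolate (h a i)

  ideals-raw : RawPx ℓ
  ideals-raw = record { Car = List Car ; _≤_ = _≼_ ; _≺_ = _≪_ }

  separate : ∀ {B C d} → ∃[ e ] (e ∈ B ++ C × d ≺ e) →
             (∃[ e ] (e ∈ B × d ≺ e)) ⊎ (∃[ e ] (e ∈ C × d ≺ e))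
  separate {B} (e , i , p) with ∈-++⁻ B i
  ... | inj₁ j = inj₁ (e , j , p)
  ... | inj₂ j = inj₂ (e , j , p)

  α-from-≺ᴸ : ∀ {d A} → ∃[ e ] (e ∈ A × d ≺ e) → α d [ A ]
  α-from-≺ᴸ {d} {A} p = ≺ᴸ⇒≪ {[ d ]} {A} (λ { _ (here refl) → p }) d (here refl)

  -- An element under `A ++ B` need not be under `A` or under `B`, but each element of its
  -- interpolating list is.
  ++-J : ∀ {A B C} → (∀ a → α a [ A ] → α a [ C ]) → (∀ a → α a [ B ] → α a [ C ]) →
         ∀ a → α a [ A ++ B ] → α a [ C ]
  ++-J {A} {B} {C} f g a p with α-interpolate p
  ... | D , q , D≺ = α-bind q λ d i → lub (separate {A} {B} (D≺ d i))
    where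
    lub : ∀ {d} → (∃[ e ] (e ∈ A × d ≺ e)) ⊎ (∃[ e ] (e ∈ B × d ≺ e)) → α d [ C ]
    lub (inj₁ q) = f _ (α-from-≺ᴸ q)
    lub (inj₂ q) = g _ (α-from-≺ᴸ q)

  -- Roundedness gives `a'` strictly above `a` and under both `B` and `C ++ D`; thus `a` is under
  -- their meet, and distributivity applies.
  α-localize : ∀ {a B C D} → α a [ B ] → (∀ a → α a [ B ] → α a [ C ++ D ]) →
    ∃[ E ] (α a [ E ] × (∀ x → x ∈ E → α x (B ∷ C ∷ []) ⊎ α x (B ∷ D ∷ [])))
  α-localize {a} {B} {C} {D} p B≼CD = α-distribute B C D (meet (α-round p))
    where
    below : ∀ {a'} → α a' [ B ] → ∀ A → A ∈ B ∷ (C ++ D) ∷ [] → α a' [ A ]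
    below q _ (here refl) = q
    below q _ (there (here refl)) = B≼CD _ q
    meet : ∃[ a' ] (a ≺ a' × α a' [ B ]) → α a (B ∷ (C ++ D) ∷ [])
    meet (a' , a≺a' , q) = α-meet a≺a' (below q)

  ≪-both : ∀ {B C E} → (∀ x → x ∈ E → α x (B ∷ C ∷ [])) → E ≪ B × E ≪ C
  ≪-both f = (λ x i → α-component (f x i) (here refl)) ,
             (λ x i → α-component (f x i) (there (here refl)))

  -- Otherwise the coherence conditions of the equivalence, which mention nested
  -- composites of the object maps, send conversion checking into these proofs.
  abstract
    ≼-refl : ∀ {A} → A ≼ A
    ≼-refl = (λ _ p → p) , (λ _ p → p)

    ≼-trans : ∀ {A B C} → A ≼ B → B ≼ C → A ≼ C
    ≼-trans (f , g) (f' , g') = (λ a → f' a ∘ f a) , (λ C → g C ∘ g' C)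

    ≪-ideal : ∀ C → IsRoundedIdeal ideals-raw (λ A → A ≪ C)
    ≪-ideal C = record
      { down = λ (_ , g) → g C
      ; inhabited = [] , λ _ ()
      ; directed = λ {A} {B} p q → A ++ B , ++-≪ p q , ⊆⇒≼ ∈-++⁺ˡ , ⊆⇒≼ (∈-++⁺ʳ A)
      ; rounded = λ A →
          (λ p → let (B , q , r) = ≪-interpolate p in B , q , ≺ᴸ⇒≪ r) ,
          (λ (B , p , q) → ≪-trans p q)
      }

    ≪-upper : ∀ A → IsRoundedUpper ideals-raw (λ C → A ≪ C)
    ≪-upper A = record
      { up = λ (f , _) p a i → f a (p a i)
      ; rounded = λ C →
          (λ p → let (B , q , r) = ≪-interpolate p in B , ≺ᴸ⇒≪ r , q) ,
          (λ (B , p , q) → ≪-trans q p)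
      }

    []-least : ∀ A → [] ≼ A
    []-least _ = ⊆⇒≼ λ ()

    ++-upper₁ : ∀ A B → A ≼ A ++ B
    ++-upper₁ _ _ = ⊆⇒≼ ∈-++⁺ˡ

    ++-upper₂ : ∀ A B → B ≼ A ++ B
    ++-upper₂ A _ = ⊆⇒≼ (∈-++⁺ʳ A)

    ++-least : ∀ {A B C} → A ≼ C → B ≼ C → A ++ B ≼ C
    ++-least {A} {B} {C} (f , g) (f' , g') =
      ++-J {A} {B} {C} f f' , λ D p → ++-≪ {A} {B} (g D p) (g' D p)

    []-strong : ∀ {A} → A ≪ [] → A ≼ [] × [] ≼ A
    []-strong p = ≪⇒≼ p , ⊆⇒≼ λ ()

    ++-strong : ∀ {A B C} → A ≪ B ++ C →
                ∃[ B' ] ∃[ C' ] (A ≼ B' ++ C' × B' ≪ B × C' ≪ C)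
    ++-strong {A} {B} {C} p with ≪-interpolate p
    ... | D , q , D≺ with split-list D (λ d i → separate {B} {C} (D≺ d i))
    ... | B' , C' , sub , f , g = B' , C' , ≪⇒≼ (≪-⊆ q sub) , ≺ᴸ⇒≪ f , ≺ᴸ⇒≪ g

    -- The covers that `α-localize` gives for the elements of `A` are pooled and then sorted by the
    -- meet under which each element lies.
    ++-localized : ∀ {A B C D} → A ≪ B → B ≼ C ++ D →
      ∃[ E ] ∃[ F ] (E ≪ B × E ≪ C × F ≪ B × F ≪ D × A ≪ E ++ F)
    ++-localized {A} {B} {C} {D} A≪B (B≼CD , _) =
      split (≪-from-pointwise (λ x → α x (B ∷ C ∷ []) ⊎ α x (B ∷ D ∷ []))
                              (λ a i → α-localize {a} {B} {C} {D} (A≪B a i) B≼CD))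
      where
      regroup : ∀ {E₁ E₂} → E₁ ≪ B × E₁ ≪ C → E₂ ≪ B × E₂ ≪ D → A ≪ E₁ ++ E₂ →
                ∃[ E ] ∃[ F ] (E ≪ B × E ≪ C × F ≪ B × F ≪ D × A ≪ E ++ F)
      regroup {E₁} {E₂} (p , q) (r , s) t = E₁ , E₂ , p , q , r , s , t
      split : ∃[ E ] (A ≪ E × (∀ x → x ∈ E → α x (B ∷ C ∷ []) ⊎ α x (B ∷ D ∷ []))) →
              ∃[ E ] ∃[ F ] (E ≪ B × E ≪ C × F ≪ B × F ≪ D × A ≪ E ++ F)
      split (E , A≪E , E-split) with split-list E E-split
      ... | E₁ , E₂ , sub , f , g = regroup (≪-both f) (≪-both g) (≪-⊆ A≪E sub)

  ideals : ProximityPoset ℓ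
  ideals = record
    { raw = ideals-raw
    ; ≤-refl = ≼-refl
    ; ≤-trans = ≼-trans
    ; ≺-ideal = ≪-ideal
    ; ≺-upper = ≪-upper
    }

  lattice : LSPxJLatObj ℓ
  lattice = record
    { px = ideals
    ; 𝟎 = []
    ; _∨_ = _++_
    ; 𝟎-least = []-least
    ; ∨-ub₁ = ++-upper₁
    ; ∨-ub₂ = ++-upper₂
    ; ∨-lub = ++-least
    ; strong-𝟎 = []-strong
    ; strong-∨ = λ {A} {B} {C} → ++-strong {A} {B} {C}
    ; localized = λ {A} {B} {C} {D} → ++-localized {A} {B} {C} {D}
    }

-- Finite joins and distributivity in a localized strong proximity semilattice.

module Joins (S : LSPxJLatObj ℓ) where
  open LSPxJLatObj S
  open PxProperties px public

  ⋁ : List Car → Car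
  ⋁ = foldr _∨_ 𝟎

  ⋁-upper : ∀ {a A} → a ∈ A → a ≤ ⋁ A
  ⋁-upper (here refl) = ∨-ub₁ _ _
  ⋁-upper (there i) = ≤-trans (⋁-upper i) (∨-ub₂ _ _)

  ⋁-least : ∀ {b} A → (∀ a → a ∈ A → a ≤ b) → ⋁ A ≤ b
  ⋁-least [] h = 𝟎-least _
  ⋁-least (a ∷ A) h = ∨-lub (h a (here refl)) (⋁-least A λ x i → h x (there i))

  ⋁-⊆ : ∀ {A B} → A ⊆ B → ⋁ A ≤ ⋁ B
  ⋁-⊆ {A} sub = ⋁-least A λ a i → ⋁-upper (sub i)

  ∨-monoʳ : ∀ {a b c} → b ≤ c → (a ∨ b) ≤ (a ∨ c)
  ∨-monoʳ p = ∨-lub (∨-ub₁ _ _) (≤-trans p (∨-ub₂ _ _))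

  ideal-∨ : ∀ {I : Subset Car} → IsRoundedIdeal raw I → ∀ {a b} → I a → I b → I (a ∨ b)
  ideal-∨ isI p q with IsRoundedIdeal.directed isI p q
  ... | c , Ic , a≤c , b≤c = IsRoundedIdeal.down isI (∨-lub a≤c b≤c) Ic

  ideal-⋁ : ∀ {I : Subset Car} → IsRoundedIdeal raw I → ∀ A → (∀ a → a ∈ A → I a) → I (⋁ A)
  ideal-⋁ isI [] h with IsRoundedIdeal.inhabited isI
  ... | x , Ix = IsRoundedIdeal.down isI (𝟎-least x) Ix
  ideal-⋁ isI (a ∷ A) h =
    ideal-∨ isI (h a (here refl)) (ideal-⋁ isI A λ x i → h x (there i))

  ∨-≺ : ∀ {a b c} → a ≺ c → b ≺ c → (a ∨ b) ≺ c
  ∨-≺ = ideal-∨ (≺-ideal _)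

  ⋁-≺ : ∀ {b} A → (∀ a → a ∈ A → a ≺ b) → ⋁ A ≺ b
  ⋁-≺ = ideal-⋁ (≺-ideal _)

  ≺ᴸ⇒⋁≺⋁ : ∀ {A B} → A ≺ᴸ B → ⋁ A ≺ ⋁ B
  ≺ᴸ⇒⋁≺⋁ {A} h = ⋁-≺ A λ a i → below (h a i)
    where
    below : ∀ {a B} → ∃[ b ] (b ∈ B × a ≺ b) → a ≺ ⋁ B
    below (b , j , p) = ≺-≤-trans p (⋁-upper j)

  -- Monotonicity of `∨` does not give this, as `≺` is not assumed to imply `≤`. Strength splits
  -- `a`, and its part under `b` moves under `c` by transitivity.
  ∨-absorb : ∀ {a b c d} → a ≺ (b ∨ d) → b ≺ c → a ≺ (c ∨ d)
  ∨-absorb p b≺c with strong-∨ p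
  ... | b' , d' , a≤ , b'≺b , d'≺d =
    ≤-≺-trans a≤ (∨-≺ (≺-≤-trans (≺-trans b'≺b b≺c) (∨-ub₁ _ _))
                      (≺-≤-trans d'≺d (∨-ub₂ _ _)))

  -- `localized` asks for `≤`; strength supplies it by passing to `c'` and `d'` strictly below `c`
  -- and `d`.
  ≺-localized : ∀ {a b c d} → a ≺ b → b ≺ (c ∨ d) →
    ∃[ a₁ ] ∃[ a₂ ] (a₁ ≺ c × a₂ ≺ b × a₂ ≺ d × a ≺ (a₁ ∨ a₂))
  ≺-localized p q with strong-∨ q
  ... | c' , d' , b≤ , c'≺c , d'≺d with localized p b≤
  ... | a₁ , a₂ , _ , a₁≺c' , a₂≺b , a₂≺d' , a≺ =
    a₁ , a₂ , ≺-trans a₁≺c' c'≺c , a₂≺b , ≺-trans a₂≺d' d'≺d , a≺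

  -- (c ∨ H₁) ∧ … ∧ (c ∨ Hₙ) ≤ c ∨ (H₁ ∧ … ∧ Hₙ), up to ≺.
  ∨-distributes-over-⋀ : ∀ {a b c} (h : List (List Car)) → a ≺ b →
    (∀ H → H ∈ h → b ≺ (c ∨ ⋁ H)) → ∃[ e ] (a ≺ (c ∨ e) × (∀ H → H ∈ h → e ≺ ⋁ H))
  ∨-distributes-over-⋀ {b = b} [] a≺b _ = b , ≺-≤-trans a≺b (∨-ub₂ _ _) , λ _ ()
  ∨-distributes-over-⋀ {c = c} (H ∷ h) a≺b b≺
    with ≺-localized a≺b (b≺ H (here refl))
  ... | a₁ , a₂ , a₁≺c , a₂≺b , a₂≺H , a≺
    with ∨-distributes-over-⋀ h a₂≺b (λ H' i → b≺ H' (there i))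
       | ≺-interpolate (∨-absorb a≺ a₁≺c)
  ... | e , a₂≺ , e≺ | m , a≺m , m≺ with strong-∨ m≺
  -- The part `q` of `m` is below `a₂`, which is under `c ∨ e`. Localizing gives `f₂` below `a₂`,
  -- hence below `⋁ H`, and below `e`, hence below the other joins; everything else is absorbed into
  -- `c`.
  ... | p , q , m≤ , p≺c , q≺a₂ with ≺-localized q≺a₂ a₂≺
  ... | f₁ , f₂ , f₁≺c , f₂≺a₂ , f₂≺e , q≺ =
    f₂ ,
    ≺-trans a≺m (≤-≺-trans m≤ (∨-≺ (≺-≤-trans p≺c (∨-ub₁ _ _)) (∨-absorb q≺ f₁≺c))) ,
    λ { _ (here refl) → ≺-trans f₂≺a₂ a₂≺H ; H' (there i) → ≺-trans f₂≺e (e≺ H' i) }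

module _ (S T : LSPxJLatObj ℓ) where
  private
    module S where
      open LSPxJLatObj S public
      open Joins S public
    module T where
      open LSPxJLatObj T public
      open Joins T public

  -- Only the two join conditions are assumed of `r`, so that the lemma also applies to `≺`, where
  -- they are the strength axioms.
  join-⋁ : {r : BRel S.Car T.Car} →
    (∀ {a} → r a T.𝟎 → a S.≈ S.𝟎) →
    (∀ {a b c} → r a (b T.∨ c) → ∃[ b' ] ∃[ c' ] (a S.≤ (b' S.∨ c') × r b' b × r c' c)) →
    ∀ {a} B → r a (T.⋁ B) → ∃[ A ] ((r ᴸ) A B × a S.≤ S.⋁ A)
  join-⋁ j0 j∨ [] p = [] , (λ _ ()) , proj₁ (j0 p)
  join-⋁ {r} j0 j∨ (b ∷ B) p with j∨ p
  ... | b' , c' , a≤ , rb'b , rc' with join-⋁ {r} j0 j∨ B rc'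
  ... | A , rAB , c'≤ = b' ∷ A , below , S.≤-trans a≤ (S.∨-monoʳ c'≤)
    where
    below : (r ᴸ) (b' ∷ A) (b ∷ B)
    below _ (here refl) = b , here refl , rb'b
    below a (there i) with rAB a i
    ... | y , j , q = y , there j , q

-- The coalgebra of a localized strong proximity semilattice.

module FrameCoalgebra (S : LSPxJLatObj ℓ) where
  open LSPxJLatObj S
  open Joins S

  strong-⋁ : ∀ {a A} → a ≺ ⋁ A → ∃[ B ] (B ≺ᴸ A × a ≺ ⋁ B)
  strong-⋁ {A = A} p with ≺-interpolate p
  ... | m , a≺m , m≺ with join-⋁ S S {_≺_} strong-𝟎 strong-∨ A m≺
  ... | B , B≺A , m≤ = B , B≺A , ≺-≤-trans a≺m m≤

  Below : Car → List (List Car) → Set _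
  Below a 𝒰 = ∀ A → A ∈ 𝒰 → a ≺ ⋁ A

  -- No element of `S` need represent the meet, so a witness `b` strictly above `a` and below each
  -- join stands in for it. At the empty family this still asks that `a` be strictly below
  -- something.
  frame-α : BRel Car (List (List Car))
  frame-α a 𝒰 = ∃[ b ] (a ≺ b × Below b 𝒰)

  frame-α⇒≺⋁ : ∀ {a 𝒰 A} → frame-α a 𝒰 → A ∈ 𝒰 → a ≺ ⋁ A
  frame-α⇒≺⋁ {A = A} (b , a≺b , h) i = ≺-trans a≺b (h A i)

  ≺⋁⇒frame-α : ∀ {a A} → a ≺ ⋁ A → frame-α a [ A ]
  ≺⋁⇒frame-α p with ≺-interpolate p
  ... | b , a≺b , b≺ = b , a≺b , λ { _ (here refl) → b≺ }

  frame-α-refine : ∀ {a 𝒰} → frame-α a 𝒰 → ∃[ 𝒱 ] (𝒱 ≺ᴸᵁ 𝒰 × frame-α a 𝒱)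
  frame-α-refine {𝒰 = 𝒰} (b , a≺b , h)
    with collect (λ A B → B ≺ᴸ A × b ≺ ⋁ B) 𝒰 (λ A i → strong-⋁ (h A i))
  ... | 𝒱 , f , g = 𝒱 , refines , b , a≺b , λ B j → proj₂ (proj₂ (proj₂ (g B j)))
    where
    refines : 𝒱 ≺ᴸᵁ 𝒰
    refines A i with f A i
    ... | B , j , p , _ = B , j , p

  abstract
    frame-α-approximable : IsApproximable raw (H raw) frame-α
    frame-α-approximable = record
      { ideal = λ 𝒰 → record
          { down = λ { p (c , b≺c , h) → c , ≤-≺-trans p b≺c , h }
          ; inhabited = 𝟎 , 𝟎 , ⋁-≺ [] (λ _ ()) , λ _ _ → ⋁-≺ [] λ _ ()
          ; directed = λ { {a} {b} (a' , a≺a' , h) (b' , b≺b' , k) →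
              (a ∨ b) ,
              ((a' ∨ b') , ∨-≺ (≺-≤-trans a≺a' (∨-ub₁ _ _)) (≺-≤-trans b≺b' (∨-ub₂ _ _)) ,
               λ A i → ∨-≺ (h A i) (k A i)) ,
              ∨-ub₁ _ _ , ∨-ub₂ _ _ }
          ; rounded = λ a → interpolate , λ { (b , a≺b , c , b≺c , h) → c , ≺-trans a≺b b≺c , h }
          }
      ; upper = λ a → record
          { up = λ { 𝒰≤𝒱 (b , a≺b , h) → b , a≺b , λ V j → coarsen h (𝒰≤𝒱 V j) }
          ; rounded = λ 𝒱 → frame-α-refine ,
              λ { (𝒰 , 𝒰≺𝒱 , b , a≺b , h) → b , a≺b , λ V j → coarsen≺ h (𝒰≺𝒱 V j) }
          }
      }
      where
      interpolate : ∀ {a 𝒰} → frame-α a 𝒰 → ∃[ b ] (a ≺ b × frame-α b 𝒰)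
      interpolate (c , a≺c , h) with ≺-interpolate a≺c
      ... | b , a≺b , b≺c = b , a≺b , c , b≺c , h
      coarsen : ∀ {b 𝒰 V} → Below b 𝒰 → ∃[ U ] (U ∈ 𝒰 × (_≤_ ᴸ) U V) → b ≺ ⋁ V
      coarsen {V = V} h (U , i , U≤V) = ≺-≤-trans (h U i) (⋁-least U λ u k → lem (U≤V u k))
        where
        lem : ∀ {u} → ∃[ v ] (v ∈ V × u ≤ v) → u ≤ ⋁ V
        lem (v , j , p) = ≤-trans p (⋁-upper j)
      coarsen≺ : ∀ {b 𝒰 V} → Below b 𝒰 → ∃[ U ] (U ∈ 𝒰 × U ≺ᴸ V) → b ≺ ⋁ V
      coarsen≺ h (U , i , U≺V) = ≺-trans (h U i) (≺ᴸ⇒⋁≺⋁ U≺V)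

    frame-counit : (counitH raw ⊚ frame-α) ≐ _≺_
    frame-counit a b = to , from
      where
      to : (counitH raw ⊚ frame-α) a b → a ≺ b
      to (𝒰 , a⊢𝒰 , W , 𝒰εW , Wεb) with Wεb b (here refl)
      ... | w , w∈W , w≺b with 𝒰εW w w∈W
      ... | A , A∈𝒰 , A≺w = ≺-trans (frame-α⇒≺⋁ a⊢𝒰 A∈𝒰) (≺-trans (⋁-≺ A below) w≺b)
        where
        below : ∀ x → x ∈ A → x ≺ w
        below x i with A≺w x i
        ... | _ , here refl , p = p
      from : a ≺ b → (counitH raw ⊚ frame-α) a b
      from p with ≺-interpolate p
      -- Three relations are composed, hence two interpolants: `a ≺ d ≺ c ≺ b`.
      ... | c , a≺c , c≺b with ≺-interpolate a≺c
      ... | d , a≺d , d≺c =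
        [ [ d ] ] , ≺⋁⇒frame-α (≺-≤-trans a≺d (⋁-upper {A = [ d ]} (here refl))) , [ c ] ,
        (λ { _ (here refl) → [ d ] , here refl , λ { _ (here refl) → c , here refl , d≺c } }) ,
        λ { _ (here refl) → c , here refl , c≺b }

  -- The offset d carries the joinands already chosen from the other members of w
  -- through the recursion.
  *-distributes : ∀ {a b d} (w : List (List (List Car))) → a ≺ b →
    (∀ B → (w *) B → b ≺ (d ∨ ⋁ (concat B))) →
    ∃[ A ] (a ≺ (d ∨ ⋁ A) × (∀ x → x ∈ A → ∃[ h ] (h ∈ w × frame-α x h)))
  *-distributes [] a≺b b≺ = [] , ≺-trans a≺b (b≺ [] refl) , λ _ ()
  *-distributes {a} {b} {d} (h ∷ w) a≺b b≺ with ≺-interpolate a≺b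
  -- For each `H` in `h` the recursion over `w` runs with `H` added to the offset; the resulting
  -- lists form `𝒜`.
  ... | m , a≺m , m≺b with collect Covers h cover
    where
    Covers : BRel (List Car) (List Car)
    Covers H A = m ≺ ((d ∨ ⋁ H) ∨ ⋁ A) × (∀ x → x ∈ A → ∃[ h ] (h ∈ w × frame-α x h))
    concat-snoc : ∀ B {H x} → x ∈ concat (B ++ [ H ]) → x ∈ H ⊎ x ∈ concat B
    concat-snoc B {H} i with ∈-concat⁻′ (B ++ [ H ]) i
    ... | C , x∈C , C∈ with ∈-++⁻ B C∈
    ... | inj₁ C∈B = inj₂ (∈-concat⁺′ x∈C C∈B)
    ... | inj₂ (here refl) = inj₁ x∈C
    bound : ∀ B {H} → (d ∨ ⋁ (concat (B ++ [ H ]))) ≤ ((d ∨ ⋁ H) ∨ ⋁ (concat B))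
    bound B {H} =
      ∨-lub (≤-trans (∨-ub₁ _ _) (∨-ub₁ _ _))
            (⋁-least (concat (B ++ [ H ])) λ x i → lem (concat-snoc B i))
      where
      lem : ∀ {x} → x ∈ H ⊎ x ∈ concat B → x ≤ ((d ∨ ⋁ H) ∨ ⋁ (concat B))
      lem (inj₁ i) = ≤-trans (⋁-upper i) (≤-trans (∨-ub₂ _ _) (∨-ub₁ _ _))
      lem (inj₂ i) = ≤-trans (⋁-upper i) (∨-ub₂ _ _)
    cover : ∀ H → H ∈ h → ∃[ A ] Covers H A
    cover H i = *-distributes w m≺b λ B B∈ →
      ≺-≤-trans (b≺ (B ++ [ H ]) (B , [ H ] , B∈ , (H , here refl) , i ∷ [] , refl)) (bound B)
  -- All bounds are weakened to the common offset `d ∨ ⋁ (concat 𝒜)`, and distributivity then leaves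
  -- one `e` below every member of `h`.
  ... | 𝒜 , f , g with ∨-distributes-over-⋀ {c = d ∨ ⋁ (concat 𝒜)} h a≺m (λ H i → bound {H} (f H i))
    where
    bound : ∀ {H} {Q : Subset (List Car)} → ∃[ A ] (A ∈ 𝒜 × m ≺ ((d ∨ ⋁ H) ∨ ⋁ A) × Q A) →
            m ≺ ((d ∨ ⋁ (concat 𝒜)) ∨ ⋁ H)
    bound (A , A∈ , m≺ , _) = ≺-≤-trans m≺
      (∨-lub (∨-lub (≤-trans (∨-ub₁ _ _) (∨-ub₁ _ _)) (∨-ub₂ _ _))
             (≤-trans (⋁-⊆ λ i → ∈-concat⁺′ i A∈) (≤-trans (∨-ub₂ _ _) (∨-ub₁ _ _))))
  ... | e , a≺ , e≺ with ≺-interpolate a≺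
  ... | n , a≺n , n≺ with strong-∨ n≺
  -- `q` replaces `e` because `frame-α` asks for a strict bound above it.
  ... | p , q , n≤ , p≺ , q≺e =
    q ∷ concat 𝒜 ,
    ≺-≤-trans (∨-absorb (≺-≤-trans a≺n n≤) p≺)
      (∨-lub (∨-monoʳ (∨-ub₂ _ _)) (≤-trans (∨-ub₁ _ _) (∨-ub₂ _ _))) ,
    approximants
    where
    approximants : ∀ x → x ∈ q ∷ concat 𝒜 → ∃[ k ] (k ∈ h ∷ w × frame-α x k)
    approximants _ (here refl) = h , here refl , e , q≺e , e≺
    approximants x (there i) with ∈-concat⁻′ 𝒜 i
    ... | A , x∈A , A∈ with g A A∈
    ... | _ , _ , _ , k with k x x∈A
    ... | h' , h'∈w , r = h' , there h'∈w , r

  -- For each `w`, `*-distributes` covers `m` by elements lying under members of `w`. These covers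
  -- make up `𝒱`, and the one `m` witnesses `frame-α a 𝒱`.
  frame-coassoc⇒ : ∀ {a 𝒰 𝔚} → frame-α a 𝒰 → Expands 𝒰 𝔚 →
    ∃[ 𝒱 ] (frame-α a 𝒱 × Hmap {S = raw} {T = H raw} frame-α 𝒱 𝔚)
  frame-coassoc⇒ {a} {𝒰} {𝔚} (b , a≺b , h) e with ≺-interpolate a≺b
  ... | m , a≺m , m≺b with collect Covers 𝔚 cover
    where
    Covers : BRel (List (List (List Car))) (List Car)
    Covers w A = m ≺ ⋁ A × (∀ x → x ∈ A → ∃[ h ] (h ∈ w × frame-α x h))
    below : ∀ {B} → ∃[ A ] (A ∈ 𝒰 × A ≺ᴸ concat B) → b ≺ (𝟎 ∨ ⋁ (concat B))
    below (A , A∈ , A≺) = ≺-≤-trans (≺-trans (h A A∈) (≺ᴸ⇒⋁≺⋁ A≺)) (∨-ub₂ _ _)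
    cover : ∀ w → w ∈ 𝔚 → ∃[ A ] Covers w A
    cover w i with *-distributes {d = 𝟎} w m≺b (λ B B∈ → below {B} (e w i B B∈))
    ... | A , m≺ , k = A , ≺-≤-trans m≺ (∨-lub (𝟎-least _) ≤-refl) , k
  ... | 𝒱 , f , g = 𝒱 , (m , a≺m , λ A j → proj₁ (proj₂ (proj₂ (g A j)))) , above
    where
    above : Hmap {S = raw} {T = H raw} frame-α 𝒱 𝔚
    above w i with f w i
    ... | A , A∈ , _ , k = A , A∈ , k

  -- The easy half of distributivity: an element under the meet `h` is under whichever member of `h`
  -- a choice `B` has picked. Finitely many choices suffice, so `𝒱` can be collected.
  frame-coassoc⇐ : ∀ {a 𝒰 𝔚} → frame-α a 𝒰 → Hmap {S = raw} {T = H raw} frame-α 𝒰 𝔚 →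
    ∃[ 𝒱 ] (frame-α a 𝒱 × Expands 𝒱 𝔚)
  frame-coassoc⇐ {a} {𝒰} {𝔚} (b , a≺b , h) k
    with collect (λ B A → A ≺ᴸ concat B × b ≺ ⋁ A) (concat (map choices 𝔚)) approximate
    where
    covered : ∀ {w B x} → (w *) B → ∃[ h ] (h ∈ w × frame-α x h) → x ≺ ⋁ (concat B)
    covered {w} B∈ (h , h∈w , p) with *-meets w h∈w B∈
    ... | H , H∈h , H∈B = ≺-≤-trans (frame-α⇒≺⋁ p H∈h) (⋁-⊆ λ i → ∈-concat⁺′ i H∈B)
    approximate : ∀ B → B ∈ concat (map choices 𝔚) → ∃[ A ] (A ≺ᴸ concat B × b ≺ ⋁ A)
    approximate B i with ∈-concat⁻′ (map choices 𝔚) i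
    ... | _ , B∈ , j with ∈-map⁻ choices j
    ... | w , w∈ , refl with k w w∈
    ... | A , A∈ , c = strong-⋁
      (≺-trans (h A A∈) (⋁-≺ A λ x l → covered (choices⊆* w B∈) (c x l)))
  ... | 𝒱 , f , g = 𝒱 , (b , a≺b , λ A j → proj₂ (proj₂ (proj₂ (g A j)))) , expands
    where
    expands : Expands 𝒱 𝔚
    expands w w∈ B B∈ with *-refines-choices w B∈
    ... | B' , B'∈ , B'⊆B with f B' (∈-concat⁺′ B'∈ (∈-map⁺ choices w∈))
    ... | A , A∈ , A≺ , _ = A , A∈ , ≺ᴸ-⊆ A≺ sub
      where
      sub : concat B' ⊆ concat B
      sub i with ∈-concat⁻′ B' i
      ... | H , x∈H , H∈ = ∈-concat⁺′ x∈H (B'⊆B H∈)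

  abstract
    frame-coassoc : (comultH raw ⊚ frame-α) ≐ (Hmap {S = raw} {T = H raw} frame-α ⊚ frame-α)
    frame-coassoc a 𝔚 = to , from
      where
      to : (comultH raw ⊚ frame-α) a 𝔚 → (Hmap {S = raw} {T = H raw} frame-α ⊚ frame-α) a 𝔚
      to (𝒰 , p , q) = frame-coassoc⇒ p (comultH⇒Expands {𝒰} q)
      from : (Hmap {S = raw} {T = H raw} frame-α ⊚ frame-α) a 𝔚 → (comultH raw ⊚ frame-α) a 𝔚
      from (𝒰 , p , q) with frame-coassoc⇐ p q
      ... | 𝒱 , r , e = 𝒱 , r , Expands⇒comultH {𝒱} e

  coalgebra : Coalg ℓ
  coalgebra = record
    { obj = px
    ; α = frame-α
    ; α-approx = frame-α-approximable
    ; counit-law = frame-counit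
    ; coassoc = frame-coassoc
    }

-- Composition of approximable relations and of coalgebra homomorphisms.

module Approximable {P Q : ProximityPoset ℓ} {r : BRel (ProximityPoset.Car P) (ProximityPoset.Car Q)}
         (approx : IsApproximable (ProximityPoset.raw P) (ProximityPoset.raw Q) r) where
  private
    module P = ProximityPoset P
    module Q = ProximityPoset Q
    module Ideal b = IsRoundedIdeal (IsApproximable.ideal approx b)
    module Upper a = IsRoundedUpper (IsApproximable.upper approx a)

  r-≺ : ∀ {a b} → r a b → ∃[ a' ] (a P.≺ a' × r a' b)
  r-≺ = proj₁ (Ideal.rounded _ _)

  ≺-r : ∀ {a a' b} → a P.≺ a' → r a' b → r a b
  ≺-r p q = proj₂ (Ideal.rounded _ _) (_ , p , q)

  r-refine : ∀ {a b} → r a b → ∃[ b' ] (b' Q.≺ b × r a b')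
  r-refine = proj₁ (Upper.rounded _ _)

  r-coarsen : ∀ {a b b'} → b' Q.≺ b → r a b' → r a b
  r-coarsen p q = proj₂ (Upper.rounded _ _) (_ , p , q)

  r∘≺ : (r ⊚ P._≺_) ≐ r
  r∘≺ _ _ = (λ { (_ , p , q) → ≺-r p q }) , r-≺

  ≺∘r : (Q._≺_ ⊚ r) ≐ r
  ≺∘r _ _ = (λ { (_ , p , q) → r-coarsen q p }) , λ p → swap (r-refine p)
    where
    swap : ∀ {a b} → ∃[ b' ] (b' Q.≺ b × r a b') → (Q._≺_ ⊚ r) a b
    swap (b' , p , q) = b' , q , p

  r-≤ : ∀ {a b b'} → r a b' → b' Q.≤ b → r a b
  r-≤ p q = Upper.up _ q p

  ≤-r : ∀ {a a' b} → a P.≤ a' → r a' b → r a b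
  ≤-r p q = Ideal.down _ p q

module _ {P Q R : ProximityPoset ℓ}
         {r : BRel (ProximityPoset.Car P) (ProximityPoset.Car Q)}
         {s : BRel (ProximityPoset.Car Q) (ProximityPoset.Car R)}
         (r-approx : IsApproximable (ProximityPoset.raw P) (ProximityPoset.raw Q) r)
         (s-approx : IsApproximable (ProximityPoset.raw Q) (ProximityPoset.raw R) s) where
  private
    module r = IsApproximable r-approx
    module s = IsApproximable s-approx
    module rA = Approximable {P = P} {Q} r-approx
    module sA = Approximable {P = Q} {R} s-approx
    module P = ProximityPoset P

  ∘-approximable : IsApproximable (ProximityPoset.raw P) (ProximityPoset.raw R) (s ⊚ r)
  ∘-approximable = record
    { ideal = λ c → record
        { down = λ { p (b , q , t) → b , rA.≤-r p q , t }
        ; inhabited = inhabited c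
        ; directed = directed
        ; rounded = λ a → rounded , λ { (a' , p , b , q , t) → b , rA.≺-r p q , t }
        }
    ; upper = λ a → record
        { up = λ { p (b , q , t) → b , q , sA.r-≤ t p }
        ; rounded = λ c → refine , λ { (c' , p , b , q , t) → b , q , sA.r-coarsen p t }
        }
    }
    where
    inhabited : ∀ c → ∃[ a ] (s ⊚ r) a c
    inhabited c with IsRoundedIdeal.inhabited (s.ideal c)
    ... | b , sbc with IsRoundedIdeal.inhabited (r.ideal b)
    ... | a , rab = a , b , rab , sbc
    directed : ∀ {a a' c} → (s ⊚ r) a c → (s ⊚ r) a' c →
               ∃[ z ] ((s ⊚ r) z c × a P.≤ z × a' P.≤ z)
    directed {c = c} (b , rab , sbc) (b' , rab' , sbc')
      with IsRoundedIdeal.directed (s.ideal c) sbc sbc'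
    ... | d , sdc , b≤d , b'≤d
      with IsRoundedIdeal.directed (r.ideal d) (rA.r-≤ rab b≤d) (rA.r-≤ rab' b'≤d)
    ... | z , rzd , p , q = z , (d , rzd , sdc) , p , q
    rounded : ∀ {a c} → (s ⊚ r) a c → ∃[ a' ] (a P.≺ a' × (s ⊚ r) a' c)
    rounded (b , rab , sbc) with rA.r-≺ rab
    ... | a' , p , q = a' , p , b , q , sbc
    refine : ∀ {a c} → (s ⊚ r) a c → ∃[ c' ] (ProximityPoset._≺_ R c' c × (s ⊚ r) a c')
    refine (b , rab , sbc) with sA.r-refine sbc
    ... | c' , p , q = c' , p , b , rab , q

-- The two squares are pasted; factoring and merging of liftings supply functoriality of `Hmap`.
∘-coalgHom : {X Y Z : Coalg ℓ} {f : BRel (Coalg.Car X) (Coalg.Car Y)} {g : BRel (Coalg.Car Y) (Coalg.Car Z)} →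
             IsCoalgHom X Y f → IsCoalgHom Y Z g → IsCoalgHom X Z (g ⊚ f)
∘-coalgHom {X = X} {Y} {Z} {f} {g} p q = record
  { approximable = ∘-approximable {P = Coalg.obj X} {Coalg.obj Y} {Coalg.obj Z} F.approximable G.approximable
  ; commutes = λ a 𝒲 → to , from
  }
  where
  module F = IsCoalgHom p
  module G = IsCoalgHom q
  to : ∀ {a 𝒲} → (Hmap {S = Coalg.raw X} {T = Coalg.raw Z} (g ⊚ f) ⊚ Coalg.α X) a 𝒲 →
       (Coalg.α Z ⊚ (g ⊚ f)) a 𝒲
  to {a} {𝒲} (𝒰 , a⊢𝒰 , h) with ᵁ-factor {r = f ᴸ} {g ᴸ} {(g ⊚ f) ᴸ} (ᴸ-factor id) {𝒰} {𝒲} h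
  ... | 𝒱 , fL , gL with proj₁ (F.commutes a 𝒱) (𝒰 , a⊢𝒰 , fL)
  ... | b , fab , b⊢𝒱 with proj₁ (G.commutes b 𝒲) (𝒱 , b⊢𝒱 , gL)
  ... | c , gbc , c⊢𝒲 = c , (b , fab , gbc) , c⊢𝒲
  from : ∀ {a 𝒲} → (Coalg.α Z ⊚ (g ⊚ f)) a 𝒲 →
         (Hmap {S = Coalg.raw X} {T = Coalg.raw Z} (g ⊚ f) ⊚ Coalg.α X) a 𝒲
  from {a} {𝒲} (c , (b , fab , gbc) , c⊢𝒲) with proj₂ (G.commutes b 𝒲) (c , gbc , c⊢𝒲)
  ... | 𝒱 , b⊢𝒱 , gL with proj₂ (F.commutes a 𝒱) (b , fab , b⊢𝒱)
  ... | 𝒰 , a⊢𝒰 , fL =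
    𝒰 , a⊢𝒰 , ᵁ-merge {r = f ᴸ} {g ᴸ} {(g ⊚ f) ᴸ} (ᴸ-merge id) {𝒰} {𝒲} (𝒱 , fL , gL)

-- Proximity relations coincide with coalgebra homomorphisms.

module _ {S T : LSPxJLatObj ℓ} where
  private
    module S where
      open LSPxJLatObj S public
      open Joins S public
      open FrameCoalgebra S public
    module T where
      open LSPxJLatObj T public
      open Joins T public
      open FrameCoalgebra T public

  module _ {r : BRel S.Car T.Car} (p : IsProximityRelation S T r) where
    private
      module p = IsProximityRelation p
      module r = Approximable {P = S.px} {T.px} p.approximable

      ⋁ᴸ : ∀ {A} B → (r ᴸ) A B → r (S.⋁ A) (T.⋁ B)
      ⋁ᴸ {A} B h = S.ideal-⋁ (IsApproximable.ideal p.approximable (T.⋁ B)) A λ a i → lem (h a i)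
        where
        lem : ∀ {a} → ∃[ b ] (b ∈ B × r a b) → r a (T.⋁ B)
        lem (b , j , q) = r.r-≤ q (T.⋁-upper j)

      -- `lawson-i` treats the empty meet and `lawson-ii` the binary one; each further member of `𝒱`
      -- uses up a strict step, supplied by interpolation.
      lawson : ∀ {a a'} 𝒱 → a S.≺ a' → (∀ V → V ∈ 𝒱 → r a' (T.⋁ V)) →
               ∃[ b ] (r a b × T.Below b 𝒱)
      lawson [] q h with p.lawson-i q
      ... | b , rab = b , rab , λ _ ()
      lawson (V ∷ 𝒱) q h with S.≺-interpolate q
      ... | m , a≺m , m≺a' with lawson 𝒱 m≺a' (λ W i → h W (there i))
      ... | b , rmb , b≺ with p.lawson-ii a≺m rmb (r.≺-r m≺a' (h V (here refl)))
      ... | d , d≺b , d≺V , rad =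
        d , rad , λ { _ (here refl) → d≺V ; W (there i) → T.≺-trans d≺b (b≺ W i) }

    -- `to` is preservation of finite meets, from the Lawson conditions; `from` is preservation of
    -- finite joins, from the join conditions.
    proximity⇒coalgHom : IsCoalgHom S.coalgebra T.coalgebra r
    proximity⇒coalgHom = record
      { approximable = p.approximable
      ; commutes = λ a 𝒱 → to , from
      }
      where
      to : ∀ {a 𝒱} → (Hmap {S = S.raw} {T = T.raw} r ⊚ S.frame-α) a 𝒱 → (T.frame-α ⊚ r) a 𝒱
      to {a} {𝒱} (𝒰 , (a' , a≺a' , h) , rLU) with lawson 𝒱 a≺a' (λ V j → covers (rLU V j))
        where
        covers : ∀ {V} → ∃[ A ] (A ∈ 𝒰 × (r ᴸ) A V) → r a' (T.⋁ V)
        covers {V} (A , i , rAV) = r.≺-r (h A i) (⋁ᴸ V rAV)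
      ... | b , rab , b≺ with r.r-refine rab
      ... | c , c≺b , rac = c , rac , b , c≺b , b≺
      from : ∀ {a 𝒱} → (T.frame-α ⊚ r) a 𝒱 → (Hmap {S = S.raw} {T = T.raw} r ⊚ S.frame-α) a 𝒱
      from {a} {𝒱} (b , rab , (b' , b≺b' , h)) with r.r-≺ rab
      ... | a'' , a≺a'' , ra''b with S.≺-interpolate a≺a''
      -- `a'` is fixed before the covers are sought, as one witness must serve all of `𝒰`.
      ... | a' , a≺a' , a'≺a''
        with collect (λ V A → (r ᴸ) A V × a' S.≺ S.⋁ A) 𝒱 (λ V j → covers (h V j))
        where
        covers : ∀ {V} → b' T.≺ T.⋁ V → ∃[ A ] ((r ᴸ) A V × a' S.≺ S.⋁ A)
        covers {V} q
          with join-⋁ S T {r} p.join-𝟎 p.join-∨ V (r.r-coarsen q (r.r-coarsen b≺b' ra''b))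
        ... | A , rAV , a''≤ = A , rAV , S.≺-≤-trans a'≺a'' a''≤
      ... | 𝒰 , f , g = 𝒰 , (a' , a≺a' , λ A i → proj₂ (proj₂ (proj₂ (g A i)))) , below
        where
        below : Hmap {S = S.raw} {T = T.raw} r 𝒰 𝒱
        below V j with f V j
        ... | A , i , rAV , _ = A , i , rAV

  module _ {r : BRel S.Car T.Car} (p : IsCoalgHom S.coalgebra T.coalgebra r) where
    private
      module p = IsCoalgHom p
      module r = Approximable {P = S.px} {T.px} p.approximable

      covered : ∀ {a b} B → r a b → b T.≺ T.⋁ B → ∃[ A ] ((r ᴸ) A B × a S.≺ S.⋁ A)
      covered {a} B rab q with proj₂ (p.commutes a [ B ]) (_ , rab , T.≺⋁⇒frame-α q)
      ... | 𝒰 , a⊢𝒰 , h with h B (here refl)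
      ... | A , i , rAB = A , rAB , S.frame-α⇒≺⋁ a⊢𝒰 i

      join-𝟎 : ∀ {a} → r a T.𝟎 → a S.≈ S.𝟎
      join-𝟎 q with r.r-refine q
      ... | b , b≺𝟎 , rab with covered [] rab b≺𝟎
      ... | [] , _ , a≺ = S.strong-𝟎 a≺
      ... | x ∷ A , h , _ with h x (here refl)
      ... | _ , () , _

      join-∨ : ∀ {a b c} → r a (b T.∨ c) →
               ∃[ b' ] ∃[ c' ] (a S.≤ (b' S.∨ c') × r b' b × r c' c)
      join-∨ {a} {b} {c} q with r.r-refine q
      ... | d , d≺ , rad with covered (b ∷ c ∷ []) rad (T.≺-≤-trans d≺ (T.∨-monoʳ (T.∨-ub₁ c T.𝟎)))
      -- `a ≺ ⋁ A` does not yield `a ≤ ⋁ A`; strength replaces `A` by a list `B` strictly below it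
      -- with `a ≤ ⋁ B`.
      ... | A , rA , a≺ with join-⋁ S S {S._≺_} S.strong-𝟎 S.strong-∨ A a≺
      ... | B , B≺A , a≤ with split-list B (λ x i → related (B≺A x i))
        where
        either : ∀ {y} → ∃[ z ] (z ∈ b ∷ c ∷ [] × r y z) → r y b ⊎ r y c
        either (_ , here refl , s) = inj₁ s
        either (_ , there (here refl) , s) = inj₂ s
        related : ∀ {x} → ∃[ y ] (y ∈ A × x S.≺ y) → r x b ⊎ r x c
        related (y , j , x≺y) with either (rA y j)
        ... | inj₁ s = inj₁ (r.≺-r x≺y s)
        ... | inj₂ s = inj₂ (r.≺-r x≺y s)
      ... | B₁ , B₂ , sub , f , g =
        S.⋁ B₁ , S.⋁ B₂ , S.≤-trans a≤ (S.⋁-least B λ x i → bound (∈-++⁻ B₁ (sub i))) ,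
        S.ideal-⋁ (IsApproximable.ideal p.approximable b) B₁ f ,
        S.ideal-⋁ (IsApproximable.ideal p.approximable c) B₂ g
        where
        bound : ∀ {x} → x ∈ B₁ ⊎ x ∈ B₂ → x S.≤ (S.⋁ B₁ S.∨ S.⋁ B₂)
        bound (inj₁ i) = S.≤-trans (S.⋁-upper i) (S.∨-ub₁ _ _)
        bound (inj₂ i) = S.≤-trans (S.⋁-upper i) (S.∨-ub₂ _ _)

    -- The join conditions come from `commutes` at families with one member, the Lawson conditions
    -- from `commutes` at the empty family and at a pair of singletons.
    coalgHom⇒proximity : IsProximityRelation S T r
    coalgHom⇒proximity = record
      { approximable = p.approximable
      ; join-𝟎 = join-𝟎
      ; join-∨ = join-∨
      ; lawson-i = lawson-i
      ; lawson-ii = lawson-ii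
      }
      where
      singleton : ∀ {a b} → a S.≺ b → S.frame-α a [ [ b ] ]
      singleton {b = b} q = S.≺⋁⇒frame-α (S.≺-≤-trans q (S.⋁-upper {A = [ b ]} (here refl)))
      lawson-i : ∀ {a a'} → a S.≺ a' → ∃[ b ] r a b
      lawson-i {a} q with proj₁ (p.commutes a []) (_ , singleton q , λ _ ())
      ... | b , rab , _ = b , rab
      lawson-ii : ∀ {a a' b c} → a S.≺ a' → r a' b → r a' c →
                  ∃[ d ] (d T.≺ b × d T.≺ c × r a d)
      lawson-ii {a} {a'} {b} {c} q s t
        with proj₁ (p.commutes a ([ b ] ∷ [ c ] ∷ [])) (_ , singleton q , below)
        where
        below : Hmap {S = S.raw} {T = T.raw} r [ [ a' ] ] ([ b ] ∷ [ c ] ∷ [])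
        below _ (here refl) = [ a' ] , here refl , λ { _ (here refl) → b , here refl , s }
        below _ (there (here refl)) = [ a' ] , here refl , λ { _ (here refl) → c , here refl , t }
      ... | d , rad , d⊢ = d , below (here refl) , below (there (here refl)) , rad
        where
        below : ∀ {x} → [ x ] ∈ [ b ] ∷ [ c ] ∷ [] → d T.≺ x
        below i = T.≺-≤-trans (T.frame-α⇒≺⋁ d⊢ i) (T.∨-lub T.≤-refl (T.𝟎-least _))

-- A coalgebra is isomorphic to the one presented by its lists.

module Realisation (X : Coalg ℓ) where
  open Coalg X
  open CoalgProperties X
  open Joins lattice using (⋁)
  open FrameCoalgebra lattice using (frame-α; coalgebra)

  -- `realise` is `≪` with a singleton on the right, and `present` is `≪` with a singleton on the
  -- left; this is why they are mutually inverse.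
  realise : BRel (List Car) Car
  realise A x = A ≪ [ x ]

  present : BRel Car (List Car)
  present x A = α x [ A ]

  -- The carrier need not have joins, but directedness of the ideal of elements under `𝒰` still
  -- replaces a list by one element, and roundedness makes the bound strict.
  α-strict-upper-bound : ∀ {𝒰} A → (∀ a → a ∈ A → α a 𝒰) →
                         ∃[ b ] (α b 𝒰 × (∀ a → a ∈ A → a ≺ b))
  α-strict-upper-bound A h with α-upper-bound A h
  ... | b , p , A≤b with α-round p
  ... | c , b≺c , q = c , q , λ a i → ≤-≺-trans (A≤b a i) b≺c

  realise-approximable : IsApproximable (ideals-raw) raw realise
  realise-approximable = record
    { ideal = λ x → ProximityPoset.≺-ideal ideals [ x ]
    ; upper = λ A → record
        { up = λ x≤y p a i → ≺⇒α (≺-≤-trans (α⇒≺ (p a i)) x≤y)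
        ; rounded = λ x → refine , λ { (y , y≺x , p) a i → ≺⇒α (≺-trans (α⇒≺ (p a i)) y≺x) }
        }
    }
    where
    refine : ∀ {A x} → A ≪ [ x ] → ∃[ y ] (y ≺ x × A ≪ [ y ])
    refine {A} p with α-strict-upper-bound A p
    ... | y , q , A≺y = y , α⇒≺ q , λ a i → ≺⇒α (A≺y a i)

  present-approximable : IsApproximable raw (ideals-raw) present
  present-approximable = record
    { ideal = λ A → IsApproximable.ideal α-approx [ A ]
    ; upper = λ x → record
        { up = λ A≼B p → proj₁ A≼B x p
        ; rounded = λ A → refine , λ { (B , B≪A , p) → α-bind p B≪A }
        }
    }
    where
    refine : ∀ {x A} → α x [ A ] → ∃[ B ] (B ≪ A × α x [ B ])
    refine p with α-interpolate p
    ... | B , q , B≺A = B , ≺ᴸ⇒≪ B≺A , q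

  -- `⋁` of `lattice` unfolds to `concat`, so an element of `⋁ U` comes from a member of `U`.
  ⋁-≪ : ∀ {U V} → (realise ᴸ) U V → ⋁ U ≪ V
  ⋁-≪ {U} {V} k a i = via (∈-concat⁻′ U i)
    where
    via : ∃[ B ] (a ∈ B × B ∈ U) → α a [ V ]
    via (B , a∈B , B∈U) with k B B∈U
    ... | v , v∈V , B≪v = α-⊆ (B≪v a a∈B) λ { (here refl) → v∈V }

  -- `α-meet` puts each element of `A` under `𝒱`; a strict upper bound then merges `A` into the
  -- single `x`.
  realise-commutes⇒ : ∀ {A A' 𝔘 𝒱} → A ≪ A' → (∀ U → U ∈ 𝔘 → A' ≪ ⋁ U) →
    ((realise ᴸ) ᵁ) 𝔘 𝒱 → ∃[ x ] (realise A x × α x 𝒱)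
  realise-commutes⇒ {A} {A'} {𝔘} {𝒱} A≪A' A'≪ h = conclude (α-strict-upper-bound A below)
    where
    A'≪V : ∀ {V} → ∃[ U ] (U ∈ 𝔘 × (realise ᴸ) U V) → A' ≪ V
    A'≪V {V} (U , U∈ , k) = ≪-trans (A'≪ U U∈) (⋁-≪ {U} {V} k)
    meet : ∀ {a} → ∃[ b ] (a ≺ b × α b [ A' ]) → α a 𝒱
    meet (b , a≺b , p) = α-meet a≺b λ V V∈ → α-bind p (A'≪V (h V V∈))
    below : ∀ a → a ∈ A → α a 𝒱
    below a i = meet (α-round (A≪A' a i))
    conclude : ∃[ x ] (α x 𝒱 × (∀ a → a ∈ A → a ≺ x)) → ∃[ x ] (realise A x × α x 𝒱)
    conclude (x , p , A≺x) = x , (λ a i → ≺⇒α (A≺x a i)) , p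

  -- Members of `𝒰` are rewritten as lists of singletons, whose join is the original member, so
  -- `[ x ]` is the witness for `frame-α`.
  realise-commutes⇐ : ∀ {A x 𝒰 𝒱} → realise A x → 𝒰 ≺ᴸᵁ 𝒱 → α x 𝒰 →
    frame-α A (map (map [_]) 𝒰) × ((realise ᴸ) ᵁ) (map (map [_]) 𝒰) 𝒱
  realise-commutes⇐ {A} {x} {𝒰} {𝒱} A≪x 𝒰≺𝒱 q = ([ x ] , A≪x , above) , below
    where
    above : ∀ U → U ∈ map (map [_]) 𝒰 → [ x ] ≪ ⋁ U
    above _ i _ (here refl) with ∈-map⁻ (map [_]) i
    ... | U , U∈ , refl = subst (λ B → α x [ B ]) (sym (concat-map-[ U ])) (α-component q U∈)
    below-V : ∀ {U V} → U ≺ᴸ V → (realise ᴸ) (map [_] U) V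
    below-V U≺V _ i with ∈-map⁻ [_] i
    ... | u , u∈ , refl with U≺V u u∈
    ... | v , v∈ , u≺v = v , v∈ , λ { _ (here refl) → ≺⇒α u≺v }
    below : ((realise ᴸ) ᵁ) (map (map [_]) 𝒰) 𝒱
    below V V∈ with 𝒰≺𝒱 V V∈
    ... | U , U∈ , U≺V = map [_] U , ∈-map⁺ (map [_]) U∈ , below-V U≺V

  realise-hom : IsCoalgHom coalgebra X realise
  realise-hom = record
    { approximable = realise-approximable
    ; commutes = λ A 𝒱 → to , from
    }
    where
    to : ∀ {A 𝒱} → (Hmap {S = ideals-raw} {T = raw} realise ⊚ frame-α) A 𝒱 →
         (α ⊚ realise) A 𝒱
    to (𝔘 , (A' , A≪A' , A'≪) , h) = realise-commutes⇒ A≪A' A'≪ h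
    from : ∀ {A 𝒱} → (α ⊚ realise) A 𝒱 →
           (Hmap {S = ideals-raw} {T = raw} realise ⊚ frame-α) A 𝒱
    from {A} {𝒱} (x , A≪x , p) = conclude (α-refine p)
      where
      conclude : ∃[ 𝒰 ] (𝒰 ≺ᴸᵁ 𝒱 × α x 𝒰) →
                 (Hmap {S = ideals-raw} {T = raw} realise ⊚ frame-α) A 𝒱
      conclude (𝒰 , 𝒰≺𝒱 , q) = map (map [_]) 𝒰 , realise-commutes⇐ A≪x 𝒰≺𝒱 q

  present-commutes⇒ : ∀ {y 𝒱 𝔘} → α y 𝒱 → ((present ᴸ) ᵁ) 𝒱 𝔘 →
                      ∀ U → U ∈ 𝔘 → α y [ ⋁ U ]
  present-commutes⇒ {y} {𝒱} y⊢𝒱 h U i = covers (h U i)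
    where
    member : ∀ {v} → ∃[ B ] (B ∈ U × α v [ B ]) → α v [ ⋁ U ]
    member (B , B∈ , p) = α-⊆ p λ j → ∈-concat⁺′ j B∈
    covers : ∃[ V ] (V ∈ 𝒱 × (present ᴸ) V U) → α y [ ⋁ U ]
    covers (V , V∈ , k) = α-bind (α-component y⊢𝒱 V∈) λ v j → member (k v j)

  present-commutes⇐ : ∀ {𝒱 𝔘} → 𝒱 ≺ᴸᵁ map concat 𝔘 → ((present ᴸ) ᵁ) 𝒱 𝔘
  present-commutes⇐ {𝒱} 𝒱≺ U U∈ = refines (𝒱≺ (concat U) (∈-map⁺ concat U∈))
    where
    presented : ∀ {v} → ∃[ u ] (u ∈ concat U × v ≺ u) → ∃[ B ] (B ∈ U × α v [ B ])
    presented (u , u∈ , v≺u) with ∈-concat⁻′ U u∈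
    ... | B , u∈B , B∈ = B , B∈ , α-⊆ (≺⇒α v≺u) λ { (here refl) → u∈B }
    refines : ∃[ V ] (V ∈ 𝒱 × V ≺ᴸ concat U) → ∃[ V ] (V ∈ 𝒱 × (present ᴸ) V U)
    refines (V , V∈ , V≺) = V , V∈ , λ v v∈ → presented (V≺ v v∈)

  present-hom : IsCoalgHom X coalgebra present
  present-hom = record
    { approximable = present-approximable
    ; commutes = λ x 𝔘 → to , from
    }
    where
    to : ∀ {x 𝔘} → (Hmap {S = raw} {T = ideals-raw} present ⊚ α) x 𝔘 →
         (frame-α ⊚ present) x 𝔘
    to {x} {𝔘} (𝒱 , x⊢𝒱 , h) = conclude (α-round x⊢𝒱)
      where
      conclude : ∃[ y ] (x ≺ y × α y 𝒱) → (frame-α ⊚ present) x 𝔘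
      conclude (y , x≺y , y⊢𝒱) = interpolated (≺-interpolate x≺y)
        where
        interpolated : ∃[ z ] (x ≺ z × z ≺ y) → (frame-α ⊚ present) x 𝔘
        interpolated (z , x≺z , z≺y) =
          [ z ] , ≺⇒α x≺z , [ y ] , (λ { _ (here refl) → ≺⇒α z≺y }) ,
          λ { U U∈ _ (here refl) → present-commutes⇒ y⊢𝒱 h U U∈ }
    from : ∀ {x 𝔘} → (frame-α ⊚ present) x 𝔘 →
           (Hmap {S = raw} {T = ideals-raw} present ⊚ α) x 𝔘
    -- Flattening the members of `𝔘` by `concat` gives a family in the range of `α`, and its
    -- refinement is the required `𝒱`.
    from {x} {𝔘} (A , x⊢A , A' , A≪A' , h) = refined (α-refine (meet (α-round x⊢A)))
      where
      below : ∀ {y} → α y [ A ] → ∀ B → B ∈ map concat 𝔘 → α y [ B ]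
      below y⊢A _ i with ∈-map⁻ concat i
      ... | U , U∈ , refl = α-bind y⊢A (≪-trans A≪A' (h U U∈))
      meet : ∃[ y ] (x ≺ y × α y [ A ]) → α x (map concat 𝔘)
      meet (y , x≺y , y⊢A) = α-meet x≺y (below y⊢A)
      refined : ∃[ 𝒱 ] (𝒱 ≺ᴸᵁ map concat 𝔘 × α x 𝒱) →
                (Hmap {S = raw} {T = ideals-raw} present ⊚ α) x 𝔘
      refined (𝒱 , 𝒱≺ , p) = 𝒱 , p , present-commutes⇐ 𝒱≺

  present∘realise : (present ⊚ realise) ≐ _≪_
  present∘realise A B = (λ { (x , A≪x , p) → ≪-trans A≪x (λ { _ (here refl) → p }) }) , from
    where
    from : A ≪ B → (present ⊚ realise) A B
    from p with α-strict-upper-bound A p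
    ... | x , q , A≺x = x , (λ a i → ≺⇒α (A≺x a i)) , q

  realise∘present : (realise ⊚ present) ≐ _≺_
  realise∘present x y = (λ { (A , p , A≪y) → α⇒≺ (α-bind p A≪y) }) , from
    where
    from : x ≺ y → (realise ⊚ present) x y
    from p with ≺-interpolate p
    ... | z , x≺z , z≺y = [ z ] , ≺⇒α x≺z , λ { _ (here refl) → ≺⇒α z≺y }

-- The two functors and the equivalence.

frames→coalgebras : Functor (LSPxJLat ℓ) (CoalgH ℓ)
frames→coalgebras = record
  { F₀ = FrameCoalgebra.coalgebra
  ; F₁ = λ r _ → r
  ; F₁-hom = λ {S} {T} r p → proximity⇒coalgHom {S = S} {T} {r} p
  ; F-resp = λ _ _ e → e
  ; F-id = λ _ _ _ _ → id , id
  ; F-comp = λ _ _ _ _ _ _ _ → id , id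
  }

module _ {P X : Set ℓ} {_≺_ : BRel X X} {e : BRel P X} {i : BRel X P} (ei : (e ⊚ i) ≐ _≺_) where

  -- `i` followed by `e` is `≺`, which `f` absorbs. This yields naturality of the unit.
  ∘-section : {Y Q : Set ℓ} {f : BRel X Y} {j : BRel Y Q} → (f ⊚ _≺_) ≐ f →
              ((j ⊚ (f ⊚ e)) ⊚ i) ≐ (j ⊚ f)
  ∘-section {f = f} {j} f≺ x q = to , from
    where
    to : ((j ⊚ (f ⊚ e)) ⊚ i) x q → (j ⊚ f) x q
    to (p , xip , y , (x' , pex' , fx'y) , yjq) =
      y , proj₁ (f≺ x y) (x' , proj₁ (ei x x') (p , xip , pex') , fx'y) , yjq
    from : (j ⊚ f) x q → ((j ⊚ (f ⊚ e)) ⊚ i) x q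
    from (y , fxy , yjq) with proj₂ (f≺ x y) fxy
    ... | x' , x≺x' , fx'y with proj₂ (ei x x') x≺x'
    ... | p , xip , pex' = p , xip , y , (x' , pex' , fx'y) , yjq

  -- Here `≺` is absorbed on the other side of `f`. This yields naturality of the counit.
  retraction-∘ : {Y Q : Set ℓ} {f : BRel Y X} {d : BRel Q Y} → (_≺_ ⊚ f) ≐ f →
                 (f ⊚ d) ≐ (e ⊚ (i ⊚ (f ⊚ d)))
  retraction-∘ {f = f} {d} ≺f q x = to , from
    where
    to : (f ⊚ d) q x → (e ⊚ (i ⊚ (f ⊚ d))) q x
    to (y , qdy , fyx) with proj₂ (≺f y x) fyx
    ... | x' , fyx' , x'≺x with proj₂ (ei x' x) x'≺x
    ... | p , x'ip , pex = p , (x' , (y , qdy , fyx') , x'ip) , pex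
    from : (e ⊚ (i ⊚ (f ⊚ d))) q x → (f ⊚ d) q x
    from (p , (x' , (y , qdy , fyx') , x'ip) , pex) =
      y , qdy , proj₁ (≺f y x) (x' , fyx' , proj₁ (ei x' x) (p , x'ip , pex))

  -- Conjugation preserves composition because the pair inserted at the middle object cancels.
  conjugate-∘ : {Y Z Q R : Set ℓ} {f : BRel Y X} {g : BRel X Z} {d : BRel Q Y} {k : BRel Z R} →
    (g ⊚ _≺_) ≐ g → (k ⊚ ((g ⊚ f) ⊚ d)) ≐ ((k ⊚ (g ⊚ e)) ⊚ (i ⊚ (f ⊚ d)))
  conjugate-∘ {f = f} {g} {d} {k} g≺ q r = to , from
    where
    to : (k ⊚ ((g ⊚ f) ⊚ d)) q r → ((k ⊚ (g ⊚ e)) ⊚ (i ⊚ (f ⊚ d))) q r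
    to (z , (y , qdy , x , fyx , gxz) , zkr) with proj₂ (∘-section {j = k} g≺ x r) (z , gxz , zkr)
    ... | p , xip , c = p , (x , (y , qdy , fyx) , xip) , c
    from : ((k ⊚ (g ⊚ e)) ⊚ (i ⊚ (f ⊚ d))) q r → (k ⊚ ((g ⊚ f) ⊚ d)) q r
    from (p , (x , (y , qdy , fyx) , xip) , c) with proj₁ (∘-section {j = k} g≺ x r) (p , xip , c)
    ... | z , gxz , zkr = z , (y , qdy , x , fyx , gxz) , zkr

conjugate-id : {P X : Set ℓ} {_≺_ : BRel X X} {_≪_ : BRel P P} {e : BRel P X} {i : BRel X P} →
  (i ⊚ e) ≐ _≪_ → (_≺_ ⊚ e) ≐ e → (i ⊚ (_≺_ ⊚ e)) ≐ _≪_
conjugate-id {_≺_ = _≺_} {_≪_} {e} {i} ie ≺e p q = to , from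
  where
  to : (i ⊚ (_≺_ ⊚ e)) p q → p ≪ q
  to (x , c , xiq) = proj₁ (ie p q) (x , proj₁ (≺e p x) c , xiq)
  from : p ≪ q → (i ⊚ (_≺_ ⊚ e)) p q
  from h with proj₂ (ie p q) h
  ... | x , pex , xiq = x , proj₂ (≺e p x) pex , xiq

module _ (X Y : Coalg ℓ) (f : BRel (Coalg.Car X) (Coalg.Car Y)) where
  private
    module X = Realisation X
    module Y = Realisation Y

  conjugate : BRel (List (Coalg.Car X)) (List (Coalg.Car Y))
  conjugate = Y.present ⊚ (f ⊚ X.realise)

  conjugate-proximity : IsCoalgHom X Y f →
    IsProximityRelation (CoalgProperties.lattice X) (CoalgProperties.lattice Y) conjugate
  conjugate-proximity p =
    coalgHom⇒proximity {S = CoalgProperties.lattice X} {T = CoalgProperties.lattice Y} {r = conjugate}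
      (∘-coalgHom {X = coalgebra (CoalgProperties.lattice X)} {Y = Y}
                  {Z = coalgebra (CoalgProperties.lattice Y)} {f = f ⊚ X.realise} {g = Y.present}
        (∘-coalgHom {X = coalgebra (CoalgProperties.lattice X)} {Y = X} {Z = Y}
                    {f = X.realise} {g = f} X.realise-hom p)
        Y.present-hom)
    where open FrameCoalgebra using (coalgebra)

coalgebras→frames : Functor (CoalgH ℓ) (LSPxJLat ℓ)
coalgebras→frames = record
  { F₀ = CoalgProperties.lattice
  ; F₁ = λ {X} {Y} f _ → conjugate X Y f
  ; F₁-hom = λ {X} {Y} f p → conjugate-proximity X Y f p
  ; F-resp = λ _ _ h A B →
      (λ { (y , (x , Ax , fxy) , yB) → y , (x , Ax , proj₁ (h x y) fxy) , yB }) ,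
      (λ { (y , (x , Ax , fxy) , yB) → y , (x , Ax , proj₂ (h x y) fxy) , yB })
  ; F-id = λ X _ → conjugate-id {e = realise X} {present X} (present∘realise X)
      (Approximable.≺∘r {P = CoalgProperties.ideals X} {Coalg.obj X} (realise-approximable X))
  ; F-comp = λ {X} {Y} {Z} f g p q _ →
      conjugate-∘ {e = realise Y} {present Y} (realise∘present Y) {f = f} {g} {realise X} {present Z}
        (Approximable.r∘≺ {P = Coalg.obj Y} {Coalg.obj Z} (IsCoalgHom.approximable q))
  }
  where open Realisation

theorem3p56 : (ℓ : Level) → Equivalence (LSPxJLat ℓ) (CoalgH ℓ)
theorem3p56 ℓ = record
  { F = frames→coalgebras
  ; G = coalgebras→frames
  -- The unit at `S` is the isomorphism already found for `coalgebra S`; fullness turns it into a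
  -- proximity relation.
  ; η = λ S → present (coalgebra S)
  ; η-hom = λ S → coalgHom⇒proximity {S = S} {lattice (coalgebra S)} {present (coalgebra S)}
                    (present-hom (coalgebra S))
  ; η⁻ = λ S → realise (coalgebra S)
  ; η⁻-hom = λ S → coalgHom⇒proximity {S = lattice (coalgebra S)} {S} {realise (coalgebra S)}
                     (realise-hom (coalgebra S))
  ; η-iso₁ = λ S → realise∘present (coalgebra S)
  ; η-iso₂ = λ S → present∘realise (coalgebra S)
  ; η-nat = λ {S} {T} r p →
      ∘-section {e = realise (coalgebra S)} {present (coalgebra S)}
        (realise∘present (coalgebra S)) {f = r} {present (coalgebra T)}
        (Approximable.r∘≺ {P = LSPxJLatObj.px S} {LSPxJLatObj.px T}
          (IsProximityRelation.approximable p))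
  ; ε = realise
  ; ε-hom = realise-hom
  ; ε⁻ = present
  ; ε⁻-hom = present-hom
  ; ε-iso₁ = present∘realise
  ; ε-iso₂ = realise∘present
  ; ε-nat = λ {X} {Y} f p →
      retraction-∘ {e = realise Y} {present Y} (realise∘present Y) {f = f} {realise X}
        (Approximable.≺∘r {P = Coalg.obj X} {Coalg.obj Y} (IsCoalgHom.approximable p))
  }
  where
  open FrameCoalgebra using (coalgebra)
  open CoalgProperties using (lattice)
  open Realisation
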